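{- Let $A$ be a circular $m\times n$ matrix without dominating rows and let $\alpha\in\mathbb{N}$. Then $Q^*(A,\alpha\mathbf{1})$ is equal to the set of points $x\in\mathbb{R}^n$ satisfying $Ax\ge\alpha\mathbf{1}$, $x\ge 0$, and all $\Gamma$-inequalities (with $b=\alpha\mathbf{1}$) for the circuits $\Gamma$ of $D(A)$ which contain no reverse row arcs, have $p(\Gamma)\ge 2$, and are such that $p(\Gamma)$ does not divide $t(\Gamma,\alpha\mathbf{1})$.
   Context: For $n\in\mathbb{N}$, $[n]=\{1,\dots,n\}$ with addition modulo $n$ (node $0$ is identified with $n$). For $a,c\in[n]$, let $t\ge0$ be minimal with $a+t\equiv c\pmod n$; $[a,c]_n=\{a+s:0\le s\le t\}$, $[a,c)_n=[a,c]_n\setminus\{c\}$. A $\{0,1\}$-matrix $A$ of order $m\times n$ is circular if for every row $i\in[m]$ there are $\ell_i,k_i\in[n]$, $2\le k_i\le n-1$, with row $i$ the incidence vector of $[\ell_i,\ell_i+k_i)_n$. A row $i$ dominates row $\ell\ne i$ if $a_{ij}\ge a_{\ell j}$ for all $j$; $A$ has no dominating rows if no row dominates another. $\mathbf 1$ is the all-ones vector; for $b\in\mathbb{Z}^m_+$, $Q(A,b)=\{x\in\mathbb{R}^n:Ax\ge b,x\ge0\}$, $Q^*(A,b)=\mathrm{conv}(Q(A,b)\cap\mathbb{Z}^n)$. $D(A)$: node set $[n]$; forward row arcs $a_i=(\ell_i-1,\ell_i+k_i-1)$, forward short arcs $a_{m+j}=(j-1,j)$, reverse row arcs $\bar a_i=(\ell_i+k_i-1,\ell_i-1)$,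 reverse short arcs $\bar a_{m+j}=(j,j-1)$ ($i\in[m]$, $j\in[n]$), with lengths $k_i,1,-k_i,-1$ respectively. A circuit is a simple directed circuit; its winding number $p(\Gamma)$ satisfies $p(\Gamma)n=\sum_{a\in E(\Gamma)}l(a)$. A forward row arc $a_i$ jumps over node $j$ iff $j\in[\ell_i,\ell_i+k_i)_n$; $(j-1,j)$ jumps over $j$ only; a reverse arc jumps over $j$ iff its antiparallel forward arc does. $p^-(\Gamma,j)$ = number of reverse arcs of $\Gamma$ jumping over $j$. For a circuit $\Gamma$ with $p(\Gamma)\ne0$: $t(\Gamma,b)=\sum_{i:a_i\in E(\Gamma)}b_i-\sum_{i:\bar a_i\in E(\Gamma)}b_i$, $\beta=\lfloor t(\Gamma,b)/p(\Gamma)\rfloor$, $r=t(\Gamma,b)-\beta p(\Gamma)$, and the $\Gamma$-inequality is $\sum_{j\in[n]}(p^-(\Gamma,j)+r)x_j\ge r(\beta+1)+\sum_{i:\bar a_i\in E(\Gamma)}b_i$.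
   Formalization: The points x are taken in ℚⁿ instead of ℝⁿ, and the convex hull Q*(A,α1) is formed with rational convex coefficients. -}

module Defs where

open import Data.Nat as ℕ using (ℕ; zero; suc; _∸_; _<_; _≤_; _≤ᵇ_)
import Data.Nat
open import Data.Nat.DivMod using (_mod_)
open import Data.Fin using (Fin; toℕ)
open import Data.Integer as ℤ using (ℤ; +_; -_)
open import Data.Integer.Divisibility using () renaming (_∣_ to _∣ℤ_)
open import Data.Rational as ℚ using (ℚ; 0ℚ; 1ℚ)
open import Data.Bool using (Bool; true; false; if_then_else_)
open import Data.List using (List; []; _∷_; map)
open import Data.List.Relation.Unary.All using (All)
open import Data.List.Relation.Unary.Unique.Propositional using (Unique)
open import Data.Product using (Σ; _×_; ∃; _,_)
open import Data.Empty using (⊥)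
open import Data.Unit using (⊤)
open import Relation.Nullary using (¬_)
open import Relation.Binary.PropositionalEquality using (_≡_; _≢_)

-- Conventions.  The node set [n] = {1,…,n} (with 0 identified with n)
-- is represented by Fin n: the element v : Fin n stands for the node
-- (residue class) toℕ v mod n, so Fin-index 0 is node n.  Columns of
-- the matrix (coordinates of x) are indexed by the same Fin n.

shift : ∀ {n} → Fin n → ℕ → Fin n
shift {suc n} a s = (toℕ a ℕ.+ s) mod (suc n)

offset : ∀ {n} → Fin n → Fin n → ℕ
offset {n} a c = if toℕ a ≤ᵇ toℕ c then toℕ c ∸ toℕ a else (toℕ c ℕ.+ n) ∸ toℕ a

InInterval : ∀ {n} → Fin n → Fin n → ℕ → Set
InInterval j a k = offset a j < k

IsCircular : ∀ {m n} → (Fin m → Fin n → ℕ) → (Fin m → Fin n) → (Fin m → ℕ) → Set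
IsCircular {m} {n} A ℓ k =
  ∀ (i : Fin m) → 2 ≤ k i × k i ≤ n ∸ 1 ×
    (∀ (j : Fin n) → (InInterval j (ℓ i) (k i) → A i j ≡ 1) × (¬ (InInterval j (ℓ i) (k i)) → A i j ≡ 0))

Dominates : ∀ {m n} → (Fin m → Fin n → ℕ) → Fin m → Fin m → Set
Dominates {n = n} A i l = ∀ (j : Fin n) → A l j ≤ A i j

NoDominatingRows : ∀ {m n} → (Fin m → Fin n → ℕ) → Set
NoDominatingRows {m} A = ∀ (i l : Fin m) → i ≢ l → ¬ Dominates A i l

sumℚ : ∀ {n} → (Fin n → ℚ) → ℚ
sumℚ {zero} f = 0ℚ
sumℚ {suc n} f = f Fin.zero ℚ.+ sumℚ (λ j → f (Fin.suc j))

ℕtoℚ : ℕ → ℚ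
ℕtoℚ a = (+ a) ℚ./ 1

ℤtoℚ : ℤ → ℚ
ℤtoℚ a = a ℚ./ 1

rowDot : ∀ {m n} → (Fin m → Fin n → ℕ) → Fin m → (Fin n → ℚ) → ℚ
rowDot A i x = sumℚ (λ j → ℕtoℚ (A i j) ℚ.* x j)

InQ : ∀ {m n} → (Fin m → Fin n → ℕ) → ℕ → (Fin n → ℚ) → Set
InQ {m} {n} A α x = (∀ (i : Fin m) → ℕtoℚ α ℚ.≤ rowDot A i x) × (∀ (j : Fin n) → 0ℚ ℚ.≤ x j)

InQstar : ∀ {m n} → (Fin m → Fin n → ℕ) → ℕ → (Fin n → ℚ) → Set
InQstar {m} {n} A α x =
  Σ (List (ℚ × (Fin n → ℤ))) λ L →
    All (λ { (λt , z) → 0ℚ ℚ.≤ λt × InQ A α (λ j → ℤtoℚ (z j)) }) L ×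
    sumL (map (λ { (λt , z) → λt }) L) ≡ 1ℚ ×
    (∀ (j : Fin n) → x j ≡ sumL (map (λ { (λt , z) → λt ℚ.* ℤtoℚ (z j) }) L))
  where
  sumL : List ℚ → ℚ
  sumL [] = 0ℚ
  sumL (q ∷ qs) = q ℚ.+ sumL qs

data Arc (m n : ℕ) : Set where
  rowF   : Fin m → Arc m n   -- a_i         = (ℓ_i - 1, ℓ_i + k_i - 1), length  k_i
  shortF : Fin n → Arc m n   -- a_{m+j}     = (j - 1, j),               length  1
  rowR   : Fin m → Arc m n   -- reverse a_i = (ℓ_i + k_i - 1, ℓ_i - 1), length -k_i
  shortR : Fin n → Arc m n   -- reverse     = (j, j - 1),               length -1

module _ {m n : ℕ} (ℓ : Fin m → Fin n) (k : Fin m → ℕ) where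

  tailA : Arc m n → Fin n
  tailA (rowF i)   = shift (ℓ i) (n ∸ 1)
  tailA (shortF j) = shift j (n ∸ 1)
  tailA (rowR i)   = shift (ℓ i) (k i ℕ.+ (n ∸ 1))
  tailA (shortR j) = j

  headA : Arc m n → Fin n
  headA (rowF i)   = shift (ℓ i) (k i ℕ.+ (n ∸ 1))
  headA (shortF j) = j
  headA (rowR i)   = shift (ℓ i) (n ∸ 1)
  headA (shortR j) = shift j (n ∸ 1)

  lengthA : Arc m n → ℤ
  lengthA (rowF i)   = + k i
  lengthA (shortF j) = + 1
  lengthA (rowR i)   = - (+ k i)
  lengthA (shortR j) = - (+ 1)

  Walk : Fin n → List (Arc m n) → Fin n → Set
  Walk u [] v = u ≡ v
  Walk u (e ∷ es) v = tailA e ≡ u × Walk (headA e) es v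

  IsCircuit : List (Arc m n) → Set
  IsCircuit [] = ⊥
  IsCircuit (e ∷ es) = Walk (tailA e) (e ∷ es) (tailA e) × Unique (map tailA (e ∷ es))

  totalLength : List (Arc m n) → ℤ
  totalLength [] = + 0
  totalLength (e ∷ es) = lengthA e ℤ.+ totalLength es

  WindingNumber : List (Arc m n) → ℤ → Set
  WindingNumber Γ p = p ℤ.* (+ n) ≡ totalLength Γ

  IsRevRow : Arc m n → Set
  IsRevRow (rowR i) = ⊤
  IsRevRow _ = ⊥

  NoReverseRowArcs : List (Arc m n) → Set
  NoReverseRowArcs Γ = All (λ e → ¬ IsRevRow e) Γ

  RevJumps : Arc m n → Fin n → Bool
  RevJumps (rowR i) j = offset (ℓ i) j ℕ.<ᵇ k i
  RevJumps (shortR j') j = toℕ j' ℕ.≡ᵇ toℕ j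
  RevJumps _ j = false

  pMinus : List (Arc m n) → Fin n → ℕ
  pMinus [] j = 0
  pMinus (e ∷ es) j = (if RevJumps e j then 1 else 0) ℕ.+ pMinus es j

  tVal : ℕ → List (Arc m n) → ℤ
  tVal α [] = + 0
  tVal α (rowF i ∷ es) = + α ℤ.+ tVal α es
  tVal α (rowR i ∷ es) = - (+ α) ℤ.+ tVal α es
  tVal α (_ ∷ es) = tVal α es

  revRowSum : ℕ → List (Arc m n) → ℕ
  revRowSum α [] = 0
  revRowSum α (rowR i ∷ es) = α ℕ.+ revRowSum α es
  revRowSum α (_ ∷ es) = revRowSum α es

  -- x satisfies the Γ-inequality (b = α·1) where p = p(Γ) > 0:
  -- with β = ⌊t/p⌋ and r = t - β p (i.e. t = β p + r, 0 ≤ r < p),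
  --   Σ_j (p⁻(Γ,j) + r) x_j ≥ r (β + 1) + Σ_{ā_i ∈ Γ} b_i
  GammaIneq : ℕ → List (Arc m n) → ℕ → (Fin n → ℚ) → Set
  GammaIneq α Γ p x =
    ∀ (β : ℤ) (r : ℕ) → tVal α Γ ≡ β ℤ.* (+ p) ℤ.+ (+ r) → r < p →
      ℤtoℚ ((+ r) ℤ.* (β ℤ.+ + 1) ℤ.+ + revRowSum α Γ)
        ℚ.≤ sumℚ (λ j → ℕtoℚ (pMinus Γ j ℕ.+ r) ℚ.* x j)

  InSystem : (Fin m → Fin n → ℕ) → ℕ → (Fin n → ℚ) → Set
  InSystem A α x =
    InQ A α x ×
    (∀ (Γ : List (Arc m n)) (p : ℕ) → IsCircuit Γ → NoReverseRowArcs Γ →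
       WindingNumber Γ (+ p) → 2 ≤ p → ¬ ((+ p) ∣ℤ tVal α Γ) →
       GammaIneq α Γ p x)

module Submission where

-- Row i covers the arc of the circle from ℓ_i - 1 to ℓ_i + k_i - 1, so A x ≥ α together with a
-- prescribed sum 1·x = β is a system of difference constraints on the partial sums of x, lifted to
-- functions R with R(s + n) = R(s) + β.  Rounding such a system down keeps it valid, and averaging
-- ⌊R + u⌋ over u recovers R: every slice {x ∈ Q : 1·x = β}, β integral, is integral.
--
-- The Γ-inequalities are valid because an integral z ∈ Q has 1·z ≤ β or 1·z ≥ β + 1.  Conversely, let
-- x satisfy the system and β = ⌊1·x⌋ < 1·x.  Splitting x into a part in the slice β and a part in
-- the slice β + 1 is again a system of difference constraints.  Without the constraints of the
-- reverse row arcs it is infeasible only if some circuit has positive gain, which a Γ-inequality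
-- excludes.  The reverse row constraints come for free when the longest-walk closure starts from
-- the proportional splitting: a walk that ends in a forward row arc, short arcs and a reverse row arc
-- is beaten by short arcs alone, because no row dominates another.

open import Defs
open import Data.Nat as ℕ using (ℕ; zero; suc; z≤n; s≤s; _∸_; _<ᵇ_; _≡ᵇ_; _≤ᵇ_)
import Data.Nat.Properties as ℕₚ
open import Data.Nat.DivMod using (_mod_; _/_; _%_; m%n<n; m<n⇒m%n≡m; [m+n]%n≡m%n; m≡m%n+[m/n]*n)
open import Data.Fin using (Fin; toℕ; _≟_)
open import Data.Fin.Properties using (toℕ-injective; toℕ<n; toℕ-fromℕ<; injective⇒≤)
open import Data.Integer using (ℤ; +_; -_; _+_; _*_; _-_; _≤_; _<_; +≤+; +<+; _⊔_; ∣_∣; _/ℕ_; _%ℕ_)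
open import Data.Integer.DivMod using ([n/ℕd]*d≤n; n<s[n/ℕd]*d; a≡a%ℕn+[a/ℕn]*n; n%ℕd<d; 0≤n⇒0≤n/ℕd)
open import Data.Integer.Properties hiding (_≟_)
open import Data.Integer.Divisibility using () renaming (_∣_ to _∣ℤ_)
open import Data.Integer.Divisibility.Signed using (∣ᵤ⇒∣; ∣⇒∣ᵤ; ∣m+n∣m⇒∣n; ∣n⇒∣m*n; ∣-refl)
open import Data.Nat.Divisibility using (>⇒∤)
open import Data.Integer.Tactic.RingSolver using (solve-∀)
open import Algebra.Properties.Semiring.Sum +-*-semiring using (sum; sum-cong-≗; *-distribˡ-sum; ∑-distrib-+)
open import Data.Rational as ℚ using (ℚ; 0ℚ; 1ℚ)
import Data.Rational.Properties as ℚₚ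
import Data.Rational.Unnormalised as ℚᵘ
import Data.Rational.Unnormalised.Properties as ℚᵘₚ
open import Data.Bool using (true; false; if_then_else_; T)
open import Data.List using (List; []; _∷_; map; _++_; length; lookup; allFin; applyDownFrom)
open import Data.List.Properties using (length-++; length-applyDownFrom)
open import Data.List.Relation.Unary.All as All using (All; []; _∷_)
import Data.List.Relation.Unary.All.Properties as All
open import Data.List.Relation.Unary.Any using (here; there)
open import Data.List.Relation.Unary.AllPairs using (AllPairs; []; _∷_)
import Data.List.Relation.Unary.AllPairs.Properties as AllPairs
open import Data.List.Membership.Propositional using (_∈_)
open import Data.List.Membership.Propositional.Properties using (∈-lookup; ∈-map⁺; ∈-++⁺ˡ; ∈-++⁺ʳ; ∈-allFin)
import Data.Rational.Solver as ℚSolver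
open import Data.Product using (Σ; ∃-syntax; _×_; _,_; proj₁; proj₂)
open import Data.Sum using (_⊎_; inj₁; inj₂)
open import Data.Empty using (⊥-elim)
open import Data.Unit using (tt)
open import Function using (_∘_)
open import Function.Bundles using (_⇔_; mk⇔)
open import Relation.Nullary using (¬_; yes; no)
open import Relation.Binary.Definitions using (tri<; tri≈; tri>)
open import Relation.Binary.PropositionalEquality using (_≡_; _≢_; refl; sym; trans; cong; cong₂; subst; subst₂; _≗_; module ≡-Reasoning)

-- Write x = X / D, S = 1·X = T + β D and D = U + T. The proportional splitting gives the two parts
-- the shares U β / S and T (β + 1) / S of X. Since β D ≤ S ≤ (β + 1) D, the part of the slice β + 1
-- already has enough on every row, whereas the part of the slice β may have too little. So only the
-- forward row constraints need repair, and the closure repairs them by raising the potential. The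
-- obstacle is that raising it could break the row constraints of the other part. A closure value is
-- either still bounded by the proportional potential, where those constraints have slack, or it
-- comes through a last row arc i. To compare i with the row l under test, both are lifted to
-- intervals of the line. Neither lifted interval may strictly contain the other, so their starts
-- are ordered as their ends are; monotonicity of the potential, or of its complement, between the
-- starts and the inequality of A x ≥ α for one of the two rows then suffice. Everything is scaled
-- to integers, so that the final convex combination is a plain average of a list of integral
-- points.

0≤-+ : ∀ {a b} → + 0 ≤ a → + 0 ≤ b → + 0 ≤ a + b
0≤-+ = +-mono-≤

0≤-* : ∀ {a b} → + 0 ≤ a → + 0 ≤ b → + 0 ≤ a * b
0≤-* {+ a} {+ b} _ _ = subst (+ 0 ≤_) (pos-* a b) (+≤+ z≤n)

≤-from-gap : ∀ {a b c} → + 0 ≤ c → b - a ≡ c → a ≤ b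
≤-from-gap 0≤c eq = 0≤i-j⇒j≤i (subst (+ 0 ≤_) (sym eq) 0≤c)

gap : ∀ {a b} → a ≤ b → + 0 ≤ b - a
gap = i≤j⇒0≤j-i

gap-< : ∀ {a b} → a < b → + 0 ≤ b - a - + 1
gap-< {a} {b} a<b = subst (+ 0 ≤_) (lem a b) (gap (i<j⇒suc[i]≤j a<b))
  where
  lem : ∀ a b → b - (+ 1 + a) ≡ b - a - + 1
  lem = solve-∀

bool-cases : ∀ b {A : Set} → (T b → A) → (¬ T b → A) → A
bool-cases true  t f = t tt
bool-cases false t f = f (λ ())

if-T : ∀ {A : Set} {x y : A} b → T b → (if b then x else y) ≡ x
if-T true _ = refl

if-¬T : ∀ {A : Set} {x y : A} b → ¬ T b → (if b then x else y) ≡ y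
if-¬T true ¬t = ⊥-elim (¬t tt)
if-¬T false _ = refl

psum : (ℕ → ℤ) → ℕ → ℤ
psum h zero    = + 0
psum h (suc k) = psum h k + h k

psum-cong : ∀ {g h} → g ≗ h → ∀ k → psum g k ≡ psum h k
psum-cong eq zero    = refl
psum-cong eq (suc k) = cong₂ _+_ (psum-cong eq k) (eq k)

δ : ∀ {n} → Fin n → Fin n → ℤ
δ v j = if toℕ v ≡ᵇ toℕ j then + 1 else + 0

sum-zero : ∀ {n} (f : Fin n → ℤ) → (∀ j → f j ≡ + 0) → sum f ≡ + 0
sum-zero {zero}  f eq = refl
sum-zero {suc n} f eq = cong₂ _+_ (eq Fin.zero) (sum-zero (f ∘ Fin.suc) (eq ∘ Fin.suc))

sum-δ : ∀ {n} (v : Fin n) (X : Fin n → ℤ) → sum (λ j → δ v j * X j) ≡ X v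
sum-δ Fin.zero X = trans
  (cong₂ _+_ (*-identityˡ (X Fin.zero)) (sum-zero _ (λ j → *-zeroˡ (X (Fin.suc j)))))
  (+-identityʳ (X Fin.zero))
sum-δ (Fin.suc v) X = trans
  (cong₂ _+_ (*-zeroˡ (X Fin.zero)) (sum-δ v (X ∘ Fin.suc)))
  (+-identityˡ (X (Fin.suc v)))

sum-≥0 : ∀ {n} (f : Fin n → ℤ) → (∀ j → + 0 ≤ f j) → + 0 ≤ sum f
sum-≥0 {zero}  f f≥0 = ≤-refl
sum-≥0 {suc n} f f≥0 = 0≤-+ (f≥0 Fin.zero) (sum-≥0 (f ∘ Fin.suc) (f≥0 ∘ Fin.suc))

≤-or-> : ∀ a b → a ≤ b ⊎ b < a
≤-or-> a b with a ≤? b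
... | yes a≤b = inj₁ a≤b
... | no  a≰b = inj₂ (≰⇒> a≰b)

-- Positions on the circle

module Cyclic (n' : ℕ) where

  n : ℕ
  n = suc n'

  node : ℕ → Fin n
  node s = s mod n

  toℕ-node : ∀ s → toℕ (node s) ≡ s % n
  toℕ-node s = toℕ-fromℕ< (m%n<n s n)

  node-toℕ : ∀ j → node (toℕ j) ≡ j
  node-toℕ j = toℕ-injective (trans (toℕ-node (toℕ j)) (m<n⇒m%n≡m (toℕ<n j)))

  node-+n : ∀ s → node (s ℕ.+ n) ≡ node s
  node-+n s = toℕ-injective (trans (toℕ-node (s ℕ.+ n))
    (trans ([m+n]%n≡m%n s n) (sym (toℕ-node s))))

  shift-turns : ∀ {B : Set} (h : ℕ → B) → (∀ s → h (s ℕ.+ n) ≡ h s) →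
    ∀ c s → h (s ℕ.+ c ℕ.* n) ≡ h s
  shift-turns h per zero    s = cong h (ℕₚ.+-identityʳ s)
  shift-turns h per (suc c) s =
    trans (cong h (sym (ℕₚ.+-assoc s n (c ℕ.* n))))
      (trans (shift-turns h per c (s ℕ.+ n)) (per s))

  periodic : ∀ {B : Set} (h : ℕ → B) → (∀ s → h (s ℕ.+ n) ≡ h s) →
    ∀ s → h (toℕ (node s)) ≡ h s
  periodic h per s = begin
    h (toℕ (node s))              ≡⟨ cong h (toℕ-node s) ⟩
    h (s % n)                     ≡⟨ shift-turns h per (s / n) (s % n) ⟨
    h (s % n ℕ.+ (s / n) ℕ.* n)   ≡⟨ cong h (m≡m%n+[m/n]*n s n) ⟨
    h s                           ∎
    where open ≡-Reasoning

  swap-last : ∀ a b c → (a ℕ.+ b) ℕ.+ c ≡ (a ℕ.+ c) ℕ.+ b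
  swap-last a b c = trans (ℕₚ.+-assoc a b c)
    (trans (cong (a ℕ.+_) (ℕₚ.+-comm b c)) (sym (ℕₚ.+-assoc a c b)))

  node-+ : ∀ a b → node (toℕ (node a) ℕ.+ b) ≡ node (a ℕ.+ b)
  node-+ a b = periodic (λ s → node (s ℕ.+ b))
    (λ s → trans (cong node (swap-last s n b)) (node-+n (s ℕ.+ b))) a

  -- Multiples of `n` are added on both sides because neither position need be the larger one in ℕ;
  -- each side receives the quotient of the other.
  node-≡ : ∀ a b → node a ≡ node b → ∃[ c ] ∃[ d ] a ℕ.+ c ℕ.* n ≡ b ℕ.+ d ℕ.* n
  node-≡ a b eq = b / n , a / n , (begin
    a ℕ.+ (b / n) ℕ.* n                              ≡⟨ cong (ℕ._+ (b / n) ℕ.* n) (m≡m%n+[m/n]*n a n) ⟩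
    (a % n ℕ.+ (a / n) ℕ.* n) ℕ.+ (b / n) ℕ.* n      ≡⟨ swap-last (a % n) _ _ ⟩
    (a % n ℕ.+ (b / n) ℕ.* n) ℕ.+ (a / n) ℕ.* n      ≡⟨ cong (λ r → (r ℕ.+ (b / n) ℕ.* n) ℕ.+ (a / n) ℕ.* n) a%n≡b%n ⟩
    (b % n ℕ.+ (b / n) ℕ.* n) ℕ.+ (a / n) ℕ.* n      ≡⟨ cong (ℕ._+ (a / n) ℕ.* n) (m≡m%n+[m/n]*n b n) ⟨
    b ℕ.+ (a / n) ℕ.* n                              ∎)
    where
    open ≡-Reasoning
    a%n≡b%n = trans (sym (toℕ-node a)) (trans (cong toℕ eq) (toℕ-node b))

  node-offset : ∀ ℓ j → node (toℕ ℓ ℕ.+ offset ℓ j) ≡ j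
  node-offset ℓ j = bool-cases (toℕ ℓ ≤ᵇ toℕ j)
    (λ t → trans (cong (λ o → node (toℕ ℓ ℕ.+ o)) (if-T _ t))
      (trans (cong node (ℕₚ.m+[n∸m]≡n (ℕₚ.≤ᵇ⇒≤ (toℕ ℓ) (toℕ j) t))) (node-toℕ j)))
    (λ f → trans (cong (λ o → node (toℕ ℓ ℕ.+ o)) (if-¬T _ f))
      (trans (cong node (ℕₚ.m+[n∸m]≡n (ℕₚ.≤-trans (ℕₚ.<⇒≤ (toℕ<n ℓ)) (ℕₚ.m≤n+m n (toℕ j)))))
        (trans (node-+n (toℕ j)) (node-toℕ j))))

  offset<n : ∀ ℓ j → offset ℓ j ℕ.< n
  offset<n ℓ j = bool-cases (toℕ ℓ ≤ᵇ toℕ j)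
    (λ t → subst (ℕ._< n) (sym (if-T _ t)) (ℕₚ.≤-<-trans (ℕₚ.m∸n≤m (toℕ j) (toℕ ℓ)) (toℕ<n j)))
    (λ f → subst (ℕ._< n) (sym (if-¬T _ f))
      (ℕₚ.m<n+o⇒m∸n<o (toℕ j ℕ.+ n) (toℕ ℓ)
        (ℕₚ.+-monoˡ-< n (ℕₚ.≰⇒> (λ le → f (ℕₚ.≤⇒≤ᵇ le))))))

  -- Adding `n ∸ toℕ ℓ` completes ℓ + s to s + n, so the node determines `s` as long as `s` is below
  -- `n`.
  node-+-cancel : ∀ (ℓ : Fin n) s t → s ℕ.< n → t ℕ.< n →
    node (toℕ ℓ ℕ.+ s) ≡ node (toℕ ℓ ℕ.+ t) → s ≡ t
  node-+-cancel ℓ s t s<n t<n eq = trans (rest s s<n)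
      (trans (cong (λ v → toℕ (node (toℕ v ℕ.+ (n ∸ toℕ ℓ)))) eq) (sym (rest t t<n)))
    where
    open ≡-Reasoning
    ℓ≤n = ℕₚ.<⇒≤ (toℕ<n ℓ)
    rest : ∀ s → s ℕ.< n → s ≡ toℕ (node (toℕ (node (toℕ ℓ ℕ.+ s)) ℕ.+ (n ∸ toℕ ℓ)))
    rest s s<n = sym (begin
      toℕ (node (toℕ (node (toℕ ℓ ℕ.+ s)) ℕ.+ (n ∸ toℕ ℓ)))  ≡⟨ cong toℕ (node-+ (toℕ ℓ ℕ.+ s) (n ∸ toℕ ℓ)) ⟩
      toℕ (node (toℕ ℓ ℕ.+ s ℕ.+ (n ∸ toℕ ℓ)))               ≡⟨ cong (λ r → toℕ (node (r ℕ.+ (n ∸ toℕ ℓ)))) (ℕₚ.+-comm (toℕ ℓ) s) ⟩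
      toℕ (node (s ℕ.+ toℕ ℓ ℕ.+ (n ∸ toℕ ℓ)))               ≡⟨ cong (toℕ ∘ node) (trans (ℕₚ.+-assoc s _ _) (cong (s ℕ.+_) (ℕₚ.m+[n∸m]≡n ℓ≤n))) ⟩
      toℕ (node (s ℕ.+ n))                                   ≡⟨ cong toℕ (node-+n s) ⟩
      toℕ (node s)                                           ≡⟨ toℕ-node s ⟩
      s % n                                                  ≡⟨ m<n⇒m%n≡m s<n ⟩
      s                                                      ∎)

  offset-node : ∀ ℓ t → t ℕ.< n → offset ℓ (node (toℕ ℓ ℕ.+ t)) ≡ t
  offset-node ℓ t t<n = node-+-cancel ℓ _ t (offset<n ℓ _) t<n (node-offset ℓ _)

  indicator : Fin n → ℕ → Fin n → ℤ
  indicator ℓ k j = if offset ℓ j <ᵇ k then + 1 else + 0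

  indicator-< : ∀ ℓ k j → offset ℓ j ℕ.< k → indicator ℓ k j ≡ + 1
  indicator-< ℓ k j lt = if-T _ (ℕₚ.<⇒<ᵇ lt)

  indicator-≮ : ∀ ℓ k j → ¬ (offset ℓ j ℕ.< k) → indicator ℓ k j ≡ + 0
  indicator-≮ ℓ k j ge = if-¬T _ (λ t → ge (ℕₚ.<ᵇ⇒< _ _ t))

  -- With `k < n` the new endpoint ℓ + k is not yet in the interval, so it contributes one unit
  -- vector; this makes row products telescope in `sum-indicator`.
  indicator-suc : ∀ ℓ k j → k ℕ.< n →
    indicator ℓ (suc k) j ≡ indicator ℓ k j + δ (node (toℕ ℓ ℕ.+ k)) j
  indicator-suc ℓ k j k<n with ℕₚ.<-cmp (offset ℓ j) k
  ... | tri< lt ne _ = trans (indicator-< ℓ (suc k) j (ℕₚ.m≤n⇒m≤1+n lt))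
        (sym (cong₂ _+_ (indicator-< ℓ k j lt) (if-¬T _ (λ t → ne (sym (trans (sym (offset-node ℓ k k<n))
          (cong (offset ℓ) (toℕ-injective (ℕₚ.≡ᵇ⇒≡ _ _ t)))))))))
  ... | tri≈ nlt eq _ = trans (indicator-< ℓ (suc k) j (s≤s (ℕₚ.≤-reflexive eq)))
        (sym (cong₂ _+_ (indicator-≮ ℓ k j nlt) (if-T _ (ℕₚ.≡⇒≡ᵇ _ _
          (cong toℕ (trans (cong (λ o → node (toℕ ℓ ℕ.+ o)) (sym eq)) (node-offset ℓ j)))))))
  ... | tri> nlt ne gt = trans (indicator-≮ ℓ (suc k) j (λ { (s≤s le) → ℕₚ.<⇒≱ gt le }))
        (sym (cong₂ _+_ (indicator-≮ ℓ k j nlt) (if-¬T _ (λ t → ne (sym (trans (sym (offset-node ℓ k k<n))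
          (cong (offset ℓ) (toℕ-injective (ℕₚ.≡ᵇ⇒≡ _ _ t)))))))))

  sum-indicator : ∀ ℓ (X : Fin n → ℤ) k → k ℕ.≤ n →
    sum (λ j → indicator ℓ k j * X j) ≡ psum (λ t → X (node (toℕ ℓ ℕ.+ t))) k
  sum-indicator ℓ X zero    _   = sum-zero _ (λ j → *-zeroˡ (X j))
  sum-indicator ℓ X (suc k) k<n = begin
    sum (λ j → indicator ℓ (suc k) j * X j)
      ≡⟨ sum-cong-≗ (λ j → trans (cong (_* X j) (indicator-suc ℓ k j k<n))
           (*-distribʳ-+ (X j) (indicator ℓ k j) (δ v j))) ⟩
    sum (λ j → indicator ℓ k j * X j + δ v j * X j)
      ≡⟨ ∑-distrib-+ (λ j → indicator ℓ k j * X j) (λ j → δ v j * X j) ⟩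
    sum (λ j → indicator ℓ k j * X j) + sum (λ j → δ v j * X j)
      ≡⟨ cong₂ _+_ (sum-indicator ℓ X k (ℕₚ.<⇒≤ k<n)) (sum-δ v X) ⟩
    psum (λ t → X (node (toℕ ℓ ℕ.+ t))) (suc k) ∎
    where
    open ≡-Reasoning
    v = node (toℕ ℓ ℕ.+ k)

  sum-turn : ∀ ℓ (X : Fin n → ℤ) → sum X ≡ psum (λ t → X (node (toℕ ℓ ℕ.+ t))) n
  sum-turn ℓ X = trans
    (sum-cong-≗ (λ j → sym (trans (cong (_* X j) (indicator-< ℓ n j (offset<n ℓ j))) (*-identityˡ (X j)))))
    (sum-indicator ℓ X n ℕₚ.≤-refl)

  QuasiPeriodic : (ℕ → ℤ) → ℤ → Set
  QuasiPeriodic R c = ∀ s → R (s ℕ.+ n) ≡ R s + c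

  -- The increment of `R` over the short arc (j - 1, j). The summand `n'` = n - 1 plays the part of
  -- -1 on the circle without leaving ℕ; quasi-periodicity makes the extra turn harmless.
  diff : (ℕ → ℤ) → Fin n → ℤ
  diff R j = R (suc (toℕ j ℕ.+ n')) - R (toℕ j ℕ.+ n')

  diff-node : ∀ R {c} → QuasiPeriodic R c → ∀ s → diff R (node (suc s)) ≡ R (suc s) - R s
  diff-node R {c} qp s = begin
    diff R (node (suc s))                                 ≡⟨ periodic (λ s → R (suc (s ℕ.+ n')) - R (s ℕ.+ n')) step (suc s) ⟩
    R (suc (suc s ℕ.+ n')) - R (suc s ℕ.+ n')             ≡⟨ cong (λ r → R (suc r) - R r) (sym (ℕₚ.+-suc s n')) ⟩
    R (suc s ℕ.+ n) - R (s ℕ.+ n)                         ≡⟨ cong₂ _-_ (qp (suc s)) (qp s) ⟩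
    (R (suc s) + c) - (R s + c)                           ≡⟨ cancel (R (suc s)) (R s) c ⟩
    R (suc s) - R s                                       ∎
    where
    open ≡-Reasoning
    cancel : ∀ a b c → (a + c) - (b + c) ≡ a - b
    cancel = solve-∀
    step : ∀ s → R (suc (s ℕ.+ n ℕ.+ n')) - R (s ℕ.+ n ℕ.+ n') ≡ R (suc (s ℕ.+ n')) - R (s ℕ.+ n')
    step s = trans (cong (λ r → R (suc r) - R r) (swap-last s n n'))
      (trans (cong₂ _-_ (qp (suc (s ℕ.+ n'))) (qp (s ℕ.+ n'))) (cancel (R (suc (s ℕ.+ n'))) (R (s ℕ.+ n')) c))

  psum-diff : ∀ R {c} → QuasiPeriodic R c → ∀ ℓ k →
    psum (λ t → diff R (node (ℓ ℕ.+ t))) k ≡ R (ℓ ℕ.+ n' ℕ.+ k) - R (ℓ ℕ.+ n')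
  psum-diff R qp ℓ zero = sym (trans (cong (λ r → R r - R (ℓ ℕ.+ n')) (ℕₚ.+-identityʳ (ℓ ℕ.+ n')))
    (+-inverseʳ (R (ℓ ℕ.+ n'))))
  psum-diff R qp ℓ (suc k) = begin
    psum (λ t → diff R (node (ℓ ℕ.+ t))) k + diff R (node (ℓ ℕ.+ k))
      ≡⟨ cong₂ _+_ (psum-diff R qp ℓ k) (trans (cong (diff R) node-eq) (diff-node R qp (p ℕ.+ k))) ⟩
    (R (p ℕ.+ k) - R p) + (R (suc (p ℕ.+ k)) - R (p ℕ.+ k))
      ≡⟨ telescope (R p) (R (p ℕ.+ k)) (R (suc (p ℕ.+ k))) ⟩
    R (suc (p ℕ.+ k)) - R p
      ≡⟨ cong (λ r → R r - R p) (ℕₚ.+-suc p k) ⟨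
    R (p ℕ.+ suc k) - R p ∎
    where
    open ≡-Reasoning
    p = ℓ ℕ.+ n'
    telescope : ∀ a b c → (b - a) + (c - b) ≡ c - a
    telescope = solve-∀
    node-eq : node (ℓ ℕ.+ k) ≡ node (suc (p ℕ.+ k))
    node-eq = trans (sym (node-+n (ℓ ℕ.+ k))) (cong node
      (trans (swap-last ℓ k n) (cong (ℕ._+ k) (ℕₚ.+-suc ℓ n'))))

  -- The sum starts at node 1, so the step from s to s + 1 picks up the column s + 1, the one that
  -- the short arc (s, s + 1) jumps over.
  partial : (Fin n → ℤ) → ℕ → ℤ
  partial X = psum (λ t → X (node (suc t)))

  partial-qp : ∀ X → QuasiPeriodic (partial X) (sum X)
  partial-qp X zero = begin
    partial X n                                                ≡⟨ psum-cong (λ t → cong X (sym (node-+ 1 t))) n ⟩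
    psum (λ t → X (node (toℕ (node 1) ℕ.+ t))) n               ≡⟨ sum-turn (node 1) X ⟨
    sum X                                                      ≡⟨ +-identityˡ (sum X) ⟨
    + 0 + sum X                                                ∎
    where open ≡-Reasoning
  partial-qp X (suc s) = begin
    partial X (s ℕ.+ n) + X (node (suc s ℕ.+ n))   ≡⟨ cong₂ _+_ (partial-qp X s) (cong X (node-+n (suc s))) ⟩
    (partial X s + sum X) + X (node (suc s))       ≡⟨ rearrange (partial X s) (sum X) (X (node (suc s))) ⟩
    partial X (suc s) + sum X                      ∎
    where
    open ≡-Reasoning
    rearrange : ∀ a b c → (a + b) + c ≡ (a + c) + b
    rearrange = solve-∀

  diff-partial : ∀ X j → diff (partial X) j ≡ X j
  diff-partial X j = trans (cancel (partial X (toℕ j ℕ.+ n')) _) (cong X (trans (cong node (sym (ℕₚ.+-suc (toℕ j) n')))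
      (trans (node-+n (toℕ j)) (node-toℕ j))))
    where
    cancel : ∀ a b → (a + b) - a ≡ b
    cancel = solve-∀

  Monotone : (ℕ → ℤ) → Set
  Monotone R = ∀ s → R s ≤ R (suc s)

  monotone-≤ : ∀ R → Monotone R → ∀ {s t} → s ℕ.≤ t → R s ≤ R t
  monotone-≤ R mono {s} s≤t = subst (λ t → R s ≤ R t) (ℕₚ.m+[n∸m]≡n s≤t) (go (_ ∸ s))
    where
    go : ∀ d → R s ≤ R (s ℕ.+ d)
    go zero    = ≤-reflexive (cong R (sym (ℕₚ.+-identityʳ s)))
    go (suc d) = ≤-trans (go d) (subst (λ t → R (s ℕ.+ d) ≤ R t) (sym (ℕₚ.+-suc s d)) (mono (s ℕ.+ d)))

  partial-mono : ∀ X → (∀ j → + 0 ≤ X j) → Monotone (partial X)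
  partial-mono X X≥0 s = ≤-from-gap (X≥0 (node (suc s))) (cancel (partial X s) (X (node (suc s))))
    where
    cancel : ∀ a b → (a + b) - a ≡ b
    cancel = solve-∀

  diff-mono : ∀ R → Monotone R → ∀ j → + 0 ≤ diff R j
  diff-mono R mono j = gap (mono (toℕ j ℕ.+ n'))

-- Rounding

module Floor (M' : ℕ) where

  M : ℕ
  M = suc M'

  ⌊_⌋ : ℤ → ℤ
  ⌊ a ⌋ = a /ℕ M

  floor-greatest : ∀ {q a} → q * + M ≤ a → q ≤ ⌊ a ⌋
  floor-greatest {q} {a} qM≤a = subst (q ≤_) (pred-suc ⌊ a ⌋)
    (i<j⇒i≤pred[j] (*-cancelʳ-<-nonNeg {q} {+ 1 + ⌊ a ⌋} (+ M) (≤-<-trans qM≤a (n<s[n/ℕd]*d a M))))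

  floor-mono : ∀ {a b} → a ≤ b → ⌊ a ⌋ ≤ ⌊ b ⌋
  floor-mono {a} a≤b = floor-greatest (≤-trans ([n/ℕd]*d≤n a M) a≤b)

  floor-+-≥ : ∀ a c → ⌊ a ⌋ + c ≤ ⌊ a + c * + M ⌋
  floor-+-≥ a c = floor-greatest (subst (_≤ a + c * + M) (sym (*-distribʳ-+ (+ M) ⌊ a ⌋ c))
    (+-monoˡ-≤ (c * + M) ([n/ℕd]*d≤n a M)))

  floor-+ : ∀ a c → ⌊ a + c * + M ⌋ ≡ ⌊ a ⌋ + c
  floor-+ a c = ≤-antisym
    -- The upper bound is the lower bound `floor-+-≥` applied with -c to the shifted argument.
    (≤-from-gap (gap (subst (λ b → ⌊ a + c * + M ⌋ - c ≤ ⌊ b ⌋) (cancel a c (+ M)) (floor-+-≥ (a + c * + M) (- c))))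
      (rearrange ⌊ a ⌋ ⌊ a + c * + M ⌋ c))
    (floor-+-≥ a c)
    where
    cancel : ∀ a c m → a + c * m + - c * m ≡ a
    cancel = solve-∀
    rearrange : ∀ x y c → x + c - y ≡ x - (y - c)
    rearrange = solve-∀

  psum-shift : ∀ (h : ℕ → ℤ) k → psum (h ∘ suc) k + h 0 ≡ psum h k + h k
  psum-shift h zero    = refl
  psum-shift h (suc k) = trans (swap (psum (h ∘ suc) k) (h (suc k)) (h 0)) (cong (_+ h (suc k)) (psum-shift h k))
    where
    swap : ∀ a b c → a + b + c ≡ a + c + b
    swap = solve-∀

  hermite : ℤ → ℤ
  hermite a = psum (λ u → ⌊ a + + u ⌋) M

  -- Passing from a to a + 1 shifts the M summands by one place: ⌊a⌋ leaves and ⌊a + M⌋ = ⌊a⌋ + 1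
  -- enters.
  hermite-suc : ∀ a → hermite (a + + 1) ≡ hermite a + + 1
  hermite-suc a = +-cancelʳ (begin
    hermite (a + + 1) + ⌊ a + + 0 ⌋                    ≡⟨ cong (_+ ⌊ a + + 0 ⌋) (psum-cong (λ u → cong ⌊_⌋ (+-assoc a (+ 1) (+ u))) M) ⟩
    psum (λ u → ⌊ a + + suc u ⌋) M + ⌊ a + + 0 ⌋       ≡⟨ psum-shift (λ u → ⌊ a + + u ⌋) M ⟩
    hermite a + ⌊ a + + M ⌋                            ≡⟨ cong (λ r → hermite a + ⌊ r ⌋) (turn a (+ M)) ⟩
    hermite a + ⌊ (a + + 0) + + 1 * + M ⌋              ≡⟨ cong (λ r → hermite a + r) (floor-+ (a + + 0) (+ 1)) ⟩
    hermite a + (⌊ a + + 0 ⌋ + + 1)                    ≡⟨ swap (hermite a) ⌊ a + + 0 ⌋ ⟩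
    hermite a + + 1 + ⌊ a + + 0 ⌋                      ∎)
    where
    open ≡-Reasoning
    turn : ∀ a m → a + m ≡ (a + + 0) + + 1 * m
    turn = solve-∀
    swap : ∀ x y → x + (y + + 1) ≡ x + + 1 + y
    swap = solve-∀
    cancel : ∀ x z → x + z - z ≡ x
    cancel = solve-∀
    +-cancelʳ : ∀ {x y z} → x + z ≡ y + z → x ≡ y
    +-cancelʳ {x} {y} {z} eq = trans (sym (cancel x z)) (trans (cong (_- z) eq) (cancel y z))

  hermite-+ : ∀ a d → hermite (a + + d) ≡ hermite a + + d
  hermite-+ a zero    = trans (cong hermite (+-identityʳ a)) (sym (+-identityʳ (hermite a)))
  hermite-+ a (suc d) = begin
    hermite (a + + suc d)         ≡⟨ cong hermite (swap a (+ d)) ⟩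
    hermite (a + + d + + 1)       ≡⟨ hermite-suc (a + + d) ⟩
    hermite (a + + d) + + 1       ≡⟨ cong (_+ + 1) (hermite-+ a d) ⟩
    hermite a + + d + + 1         ≡⟨ swap (hermite a) (+ d) ⟨
    hermite a + + suc d           ∎
    where
    open ≡-Reasoning
    swap : ∀ a d → a + (+ 1 + d) ≡ a + d + + 1
    swap = solve-∀

  psum-minus : ∀ g h k → psum (λ u → g u - h u) k ≡ psum g k - psum h k
  psum-minus g h zero    = refl
  psum-minus g h (suc k) = trans (cong (_+ (g k - h k)) (psum-minus g h k))
      (swap (psum g k) (psum h k) (g k) (h k))
    where
    swap : ∀ a b c d → (a - b) + (c - d) ≡ (a + c) - (b + d)
    swap = solve-∀

  -- Hermite's identity Σ_{u<M} ⌊(a + u)/M⌋ = a, in the form needed for telescoping.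
  sum-floor-differences : ∀ {a b} → a ≤ b → psum (λ u → ⌊ b + + u ⌋ - ⌊ a + + u ⌋) M ≡ b - a
  sum-floor-differences {a} {b} a≤b = begin
    psum (λ u → ⌊ b + + u ⌋ - ⌊ a + + u ⌋) M   ≡⟨ psum-minus (λ u → ⌊ b + + u ⌋) (λ u → ⌊ a + + u ⌋) M ⟩
    hermite b - hermite a                      ≡⟨ cong (λ r → hermite r - hermite a) b≡a+d ⟩
    hermite (a + + d) - hermite a              ≡⟨ cong (_- hermite a) (hermite-+ a d) ⟩
    hermite a + + d - hermite a                ≡⟨ cancel (hermite a) (+ d) ⟩
    + d                                        ≡⟨ 0≤i⇒+∣i∣≡i (gap a≤b) ⟩
    b - a                                      ∎
    where
    open ≡-Reasoning
    d = ∣ b - a ∣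
    cancel : ∀ x d → x + d - x ≡ d
    cancel = solve-∀
    restore : ∀ a b → b ≡ a + (b - a)
    restore = solve-∀
    b≡a+d : b ≡ a + + d
    b≡a+d = trans (restore a b) (cong (λ r → a + r) (sym (0≤i⇒+∣i∣≡i (gap a≤b))))

  module _ (n' : ℕ) (R : ℕ → ℤ) where
    open Cyclic n'

    rounded : ℕ → ℕ → ℤ
    rounded u s = ⌊ R s + + u ⌋

    rounded-qp : ∀ {β} → QuasiPeriodic R (β * + M) → ∀ u → QuasiPeriodic (rounded u) β
    rounded-qp {β} qp u s = trans (cong ⌊_⌋ (trans (cong (_+ + u) (qp s)) (swap (R s) (β * + M) (+ u))))
        (floor-+ (R s + + u) β)
      where
      swap : ∀ a b c → a + b + c ≡ a + c + b
      swap = solve-∀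

    -- A right-hand side that is a multiple of M passes through the floor exactly, so nothing is
    -- lost in rounding the constraint.
    rounded-gap : ∀ {a s t} → R s + a * + M ≤ R t → ∀ u → rounded u s + a ≤ rounded u t
    rounded-gap {a} {s} {t} le u = subst (_≤ rounded u t) (floor-+ (R s + + u) a)
        (floor-mono (subst (_≤ R t + + u) (swap (R s) (a * + M) (+ u)) (+-monoˡ-≤ (+ u) le)))
      where
      swap : ∀ a b c → a + b + c ≡ a + c + b
      swap = solve-∀

    rounded-mono : Monotone R → ∀ u → Monotone (rounded u)
    rounded-mono mono u s = floor-mono (+-monoˡ-≤ (+ u) (mono s))

    sum-rounded : Monotone R → ∀ j → psum (λ u → diff (rounded u) j) M ≡ diff R j
    sum-rounded mono j = sum-floor-differences (mono (toℕ j ℕ.+ n'))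

-- Convex combinations

total : ∀ {n} → List (ℚ × (Fin n → ℤ)) → ℚ
total []            = 0ℚ
total ((q , z) ∷ L) = q ℚ.+ total L

combination : ∀ {n} → List (ℚ × (Fin n → ℤ)) → Fin n → ℚ
combination []            j = 0ℚ
combination ((q , z) ∷ L) j = q ℚ.* ℤtoℚ (z j) ℚ.+ combination L j

-- The summation function inside InQstar is local and cannot be named; the left-hand sides left
-- open here are found by unification with its occurrences in the type of members of InQstar.
mutual
  total-eq : ∀ {m n} (A : Fin m → Fin n → ℕ) α (x : Fin n → ℚ) (L : List (ℚ × (Fin n → ℤ))) → _ ≡ total L
  combination-eq : ∀ {m n} (A : Fin m → Fin n → ℕ) α (x : Fin n → ℚ) (j : Fin n) (L : List (ℚ × (Fin n → ℤ))) →
    _ ≡ combination L j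

  InQstar-total : ∀ {m n} (A : Fin m → Fin n → ℕ) α (x : Fin n → ℚ) → (c : InQstar A α x) → total (proj₁ c) ≡ 1ℚ
  InQstar-total A α x (L , _ , s , _) = trans (sym (total-eq A α x L)) s

  InQstar-combination : ∀ {m n} (A : Fin m → Fin n → ℕ) α (x : Fin n → ℚ) → (c : InQstar A α x) →
    ∀ j → x j ≡ combination (proj₁ c) j
  InQstar-combination A α x (L , _ , _ , eq) j = trans (eq j) (combination-eq A α x j L)

  total-eq A α x []            = refl
  total-eq A α x ((q , z) ∷ L) = cong (q ℚ.+_) (total-eq A α x L)

  combination-eq A α x j []            = refl
  combination-eq A α x j ((q , z) ∷ L) = cong (q ℚ.* ℤtoℚ (z j) ℚ.+_) (combination-eq A α x j L)

ℤtoℚ-≃ : ∀ a → ℚ.toℚᵘ (ℤtoℚ a) ℚᵘ.≃ ℚᵘ.mkℚᵘ a 0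
ℤtoℚ-≃ a = ℚₚ.toℚᵘ-fromℚᵘ (ℚᵘ.mkℚᵘ a 0)

ℤtoℚ-+ : ∀ a b → ℤtoℚ (a + b) ≡ ℤtoℚ a ℚ.+ ℤtoℚ b
ℤtoℚ-+ a b = ℚₚ.toℚᵘ-injective (begin
  ℚ.toℚᵘ (ℤtoℚ (a + b))                        ≈⟨ ℤtoℚ-≃ (a + b) ⟩
  ℚᵘ.mkℚᵘ (a + b) 0                            ≈⟨ ℚᵘ.*≡* (lem a b) ⟩
  ℚᵘ.mkℚᵘ a 0 ℚᵘ.+ ℚᵘ.mkℚᵘ b 0                 ≈⟨ ℚᵘₚ.+-cong (ℤtoℚ-≃ a) (ℤtoℚ-≃ b) ⟨
  ℚ.toℚᵘ (ℤtoℚ a) ℚᵘ.+ ℚ.toℚᵘ (ℤtoℚ b)         ≈⟨ ℚₚ.toℚᵘ-homo-+ (ℤtoℚ a) (ℤtoℚ b) ⟨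
  ℚ.toℚᵘ (ℤtoℚ a ℚ.+ ℤtoℚ b)                   ∎)
  where
  open ℚᵘₚ.≃-Reasoning
  lem : ∀ a b → (a + b) * + 1 ≡ (a * + 1 + b * + 1) * + 1
  lem = solve-∀

ℤtoℚ-* : ∀ a b → ℤtoℚ (a * b) ≡ ℤtoℚ a ℚ.* ℤtoℚ b
ℤtoℚ-* a b = ℚₚ.toℚᵘ-injective (begin
  ℚ.toℚᵘ (ℤtoℚ (a * b))                        ≈⟨ ℤtoℚ-≃ (a * b) ⟩
  ℚᵘ.mkℚᵘ a 0 ℚᵘ.* ℚᵘ.mkℚᵘ b 0                 ≈⟨ ℚᵘₚ.*-cong (ℤtoℚ-≃ a) (ℤtoℚ-≃ b) ⟨
  ℚ.toℚᵘ (ℤtoℚ a) ℚᵘ.* ℚ.toℚᵘ (ℤtoℚ b)         ≈⟨ ℚₚ.toℚᵘ-homo-* (ℤtoℚ a) (ℤtoℚ b) ⟨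
  ℚ.toℚᵘ (ℤtoℚ a ℚ.* ℤtoℚ b)                   ∎)
  where open ℚᵘₚ.≃-Reasoning

ℤtoℚ-mono : ∀ {a b} → a ≤ b → ℤtoℚ a ℚ.≤ ℤtoℚ b
ℤtoℚ-mono {a} {b} a≤b = ℚₚ.toℚᵘ-cancel-≤ (ℚᵘₚ.≤-respˡ-≃ (ℚᵘₚ.≃-sym (ℤtoℚ-≃ a))
  (ℚᵘₚ.≤-respʳ-≃ (ℚᵘₚ.≃-sym (ℤtoℚ-≃ b)) (ℚᵘ.*≤* (*-monoʳ-≤-nonNeg (+ 1) a≤b))))

ℤtoℚ-cancel : ∀ {a b} → ℤtoℚ a ℚ.≤ ℤtoℚ b → a ≤ b
ℤtoℚ-cancel {a} {b} le with ℚᵘₚ.≤-respˡ-≃ (ℤtoℚ-≃ a) (ℚᵘₚ.≤-respʳ-≃ (ℤtoℚ-≃ b) (ℚₚ.toℚᵘ-mono-≤ le))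
... | ℚᵘ.*≤* h = subst₂ _≤_ (*-identityʳ a) (*-identityʳ b) h

ℤtoℚ-positive : ∀ d → ℚ.Positive (ℤtoℚ (+ suc d))
ℤtoℚ-positive d = ℚₚ.normalize-pos (suc d) 1

ℤtoℚ-nonNegative : ∀ d → ℚ.NonNegative (ℤtoℚ (+ suc d))
ℤtoℚ-nonNegative d = ℚₚ.pos⇒nonNeg (ℤtoℚ (+ suc d)) {{ℤtoℚ-positive d}}

dot : ∀ {n} → (Fin n → ℕ) → (Fin n → ℚ) → ℚ
dot a x = sumℚ (λ j → ℕtoℚ (a j) ℚ.* x j)

dotℤ : ∀ {n} → (Fin n → ℕ) → (Fin n → ℤ) → ℤ
dotℤ a X = sum (λ j → + a j * X j)

module Scaled (D' : ℕ) where
  D : ℤ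
  D = + suc D'

  infix 4 _≗_/D
  _≗_/D : ∀ {n} → (Fin n → ℚ) → (Fin n → ℤ) → Set
  x ≗ X /D = ∀ j → x j ℚ.* ℤtoℚ D ≡ ℤtoℚ (X j)

  dot-scaled : ∀ {n} (a : Fin n → ℕ) {x X} → x ≗ X /D → dot a x ℚ.* ℤtoℚ D ≡ ℤtoℚ (dotℤ a X)
  dot-scaled {zero}  a eq = ℚₚ.*-zeroˡ (ℤtoℚ D)
  dot-scaled {suc n} a {x} {X} eq = begin
    (ℕtoℚ (a Fin.zero) ℚ.* x Fin.zero ℚ.+ dot (a ∘ Fin.suc) (x ∘ Fin.suc)) ℚ.* ℤtoℚ D
      ≡⟨ ℚₚ.*-distribʳ-+ (ℤtoℚ D) (ℕtoℚ (a Fin.zero) ℚ.* x Fin.zero) _ ⟩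
    (ℕtoℚ (a Fin.zero) ℚ.* x Fin.zero) ℚ.* ℤtoℚ D ℚ.+ dot (a ∘ Fin.suc) (x ∘ Fin.suc) ℚ.* ℤtoℚ D
      ≡⟨ cong₂ ℚ._+_ (trans (ℚₚ.*-assoc (ℕtoℚ (a Fin.zero)) (x Fin.zero) (ℤtoℚ D))
           (trans (cong (ℕtoℚ (a Fin.zero) ℚ.*_) (eq Fin.zero)) (sym (ℤtoℚ-* (+ a Fin.zero) (X Fin.zero)))))
           (dot-scaled (a ∘ Fin.suc) (eq ∘ Fin.suc)) ⟩
    ℤtoℚ (+ a Fin.zero * X Fin.zero) ℚ.+ ℤtoℚ (dotℤ (a ∘ Fin.suc) (X ∘ Fin.suc))
      ≡⟨ ℤtoℚ-+ (+ a Fin.zero * X Fin.zero) _ ⟨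
    ℤtoℚ (dotℤ a X) ∎
    where open ≡-Reasoning

  clear-≤ : ∀ u {v q} → q ℚ.* ℤtoℚ D ≡ ℤtoℚ v → ℤtoℚ u ℚ.≤ q → u * D ≤ v
  clear-≤ u {v} eq le = ℤtoℚ-cancel (subst₂ ℚ._≤_ (sym (ℤtoℚ-* u D)) eq
    (ℚₚ.*-monoʳ-≤-nonNeg (ℤtoℚ D) {{ℤtoℚ-nonNegative D'}} le))

  unclear-≤ : ∀ u {v q} → q ℚ.* ℤtoℚ D ≡ ℤtoℚ v → u * D ≤ v → ℤtoℚ u ℚ.≤ q
  unclear-≤ u {v} eq le = ℚₚ.*-cancelʳ-≤-pos (ℤtoℚ D) {{ℤtoℚ-positive D'}}
    (subst₂ ℚ._≤_ (ℤtoℚ-* u D) (sym eq) (ℤtoℚ-mono le))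

Feasible : ∀ {m n} → (Fin m → Fin n → ℕ) → ℤ → (Fin n → ℤ) → Set
Feasible A b X = (∀ i → b ≤ dotℤ (A i) X) × (∀ j → + 0 ≤ X j)

module _ {m n} (A : Fin m → Fin n → ℕ) (α : ℕ) where
  InQ⇒Feasible : ∀ D' {x X} → let open Scaled D' in x ≗ X /D → InQ A α x → Feasible A (+ α * D) X
  InQ⇒Feasible D' {X = X} eq (rows , x≥0) =
      (λ i → clear-≤ (+ α) (dot-scaled (A i) eq) (rows i))
    , (λ j → subst (_≤ X j) (*-zeroˡ D) (clear-≤ (+ 0) (eq j) (x≥0 j)))
    where open Scaled D'

  ≗/1 : ∀ {k} (z : Fin k → ℤ) → let open Scaled 0 in (ℤtoℚ ∘ z) ≗ z /D
  ≗/1 z j = ℚₚ.*-identityʳ (ℤtoℚ (z j))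

  Feasible⇒InQ : ∀ {z} → Feasible A (+ α) z → InQ A α (ℤtoℚ ∘ z)
  Feasible⇒InQ {z} (rows , z≥0) =
      (λ i → unclear-≤ (+ α) (dot-scaled (A i) (≗/1 z)) (subst (_≤ dotℤ (A i) z) (sym (*-identityʳ (+ α))) (rows i)))
    , (λ j → ℤtoℚ-mono (z≥0 j))
    where open Scaled 0

  InQ⇒Feasibleℤ : ∀ {z} → InQ A α (ℤtoℚ ∘ z) → Feasible A (+ α) z
  InQ⇒Feasibleℤ {z} q = subst (λ b → Feasible A b z) (*-identityʳ (+ α)) (InQ⇒Feasible 0 (≗/1 z) q)

*-denominator : ∀ q → q ℚ.* ℤtoℚ (ℚ.denominator q) ≡ ℤtoℚ (ℚ.numerator q)
*-denominator q@record{} = ℚₚ.toℚᵘ-injective (begin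
  ℚ.toℚᵘ (q ℚ.* ℤtoℚ (ℚ.denominator q))                  ≈⟨ ℚₚ.toℚᵘ-homo-* q (ℤtoℚ (ℚ.denominator q)) ⟩
  ℚ.toℚᵘ q ℚᵘ.* ℚ.toℚᵘ (ℤtoℚ (ℚ.denominator q))          ≈⟨ ℚᵘₚ.*-cong (ℚᵘₚ.≃-refl {ℚ.toℚᵘ q}) (ℤtoℚ-≃ (ℚ.denominator q)) ⟩
  ℚ.toℚᵘ q ℚᵘ.* ℚᵘ.mkℚᵘ (ℚ.denominator q) 0              ≈⟨ ℚᵘ.*≡* (cancel (ℚ.numerator q) (ℚ.denominator q)) ⟩
  ℚᵘ.mkℚᵘ (ℚ.numerator q) 0                              ≈⟨ ℤtoℚ-≃ (ℚ.numerator q) ⟨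
  ℚ.toℚᵘ (ℤtoℚ (ℚ.numerator q))                          ∎)
  where
  open ℚᵘₚ.≃-Reasoning
  cancel : ∀ a d → a * d * + 1 ≡ a * (d * + 1)
  cancel = solve-∀

common-denominator : ∀ {n} (x : Fin n → ℚ) → Σ ℕ λ D' → Σ (Fin n → ℤ) λ X → let open Scaled D' in x ≗ X /D
common-denominator {zero}  x = 0 , (λ ()) , (λ ())
common-denominator {suc n} x with common-denominator (x ∘ Fin.suc)
-- Denominators are stored as predecessors: this is the product `suc d'` times `suc D'`, less one.
... | D' , X , eq = D' ℕ.+ d' ℕ.* suc D' , X⁺ , eq⁺
  where
  open Scaled D'
  open ≡-Reasoning
  x₀ = x Fin.zero
  d' = ℚ.denominator-1 x₀
  d = + suc d'
  X⁺ : Fin (suc n) → ℤ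
  X⁺ Fin.zero    = ℚ.numerator x₀ * D
  X⁺ (Fin.suc j) = X j * d
  split : ℤtoℚ (+ suc (D' ℕ.+ d' ℕ.* suc D')) ≡ ℤtoℚ d ℚ.* ℤtoℚ D
  split = trans (cong ℤtoℚ (pos-* (suc d') (suc D'))) (ℤtoℚ-* d D)
  eq⁺ : ∀ j → x j ℚ.* ℤtoℚ (+ suc (D' ℕ.+ d' ℕ.* suc D')) ≡ ℤtoℚ (X⁺ j)
  eq⁺ Fin.zero = begin
    x₀ ℚ.* ℤtoℚ (+ suc (D' ℕ.+ d' ℕ.* suc D'))   ≡⟨ cong (x₀ ℚ.*_) split ⟩
    x₀ ℚ.* (ℤtoℚ d ℚ.* ℤtoℚ D)                   ≡⟨ ℚₚ.*-assoc x₀ (ℤtoℚ d) (ℤtoℚ D) ⟨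
    x₀ ℚ.* ℤtoℚ d ℚ.* ℤtoℚ D                     ≡⟨ cong (ℚ._* ℤtoℚ D) (*-denominator x₀) ⟩
    ℤtoℚ (ℚ.numerator x₀) ℚ.* ℤtoℚ D           ≡⟨ ℤtoℚ-* (ℚ.numerator x₀) D ⟨
    ℤtoℚ (ℚ.numerator x₀ * D)                  ∎
  eq⁺ (Fin.suc j) = begin
    x (Fin.suc j) ℚ.* ℤtoℚ (+ suc (D' ℕ.+ d' ℕ.* suc D'))   ≡⟨ cong (x (Fin.suc j) ℚ.*_) (trans split (ℚₚ.*-comm (ℤtoℚ d) (ℤtoℚ D))) ⟩
    x (Fin.suc j) ℚ.* (ℤtoℚ D ℚ.* ℤtoℚ d)                   ≡⟨ ℚₚ.*-assoc (x (Fin.suc j)) (ℤtoℚ D) (ℤtoℚ d) ⟨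
    x (Fin.suc j) ℚ.* ℤtoℚ D ℚ.* ℤtoℚ d                     ≡⟨ cong (ℚ._* ℤtoℚ d) (eq j) ⟩
    ℤtoℚ (X j) ℚ.* ℤtoℚ d                                   ≡⟨ ℤtoℚ-* (X j) d ⟨
    ℤtoℚ (X j * d)                                          ∎

sumℚ-cong : ∀ {n} {f g : Fin n → ℚ} → (∀ j → f j ≡ g j) → sumℚ f ≡ sumℚ g
sumℚ-cong {zero}  eq = refl
sumℚ-cong {suc n} eq = cong₂ ℚ._+_ (eq Fin.zero) (sumℚ-cong (eq ∘ Fin.suc))

-- One interface for coordinates and row products, so that validity on integral points extends to
-- their convex combinations by a single argument. `additive` has the shape of one list cell of
-- `combination`.
record IsLinear {n} (F : (Fin n → ℚ) → ℚ) : Set where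
  field
    respects : ∀ {x y} → (∀ j → x j ≡ y j) → F x ≡ F y
    at-zero  : F (λ _ → 0ℚ) ≡ 0ℚ
    additive : ∀ q y w → F (λ j → q ℚ.* y j ℚ.+ w j) ≡ q ℚ.* F y ℚ.+ F w

eval-linear : ∀ {n} (j : Fin n) → IsLinear (λ x → x j)
eval-linear j = record { respects = λ eq → eq j ; at-zero = refl ; additive = λ _ _ _ → refl }

dot-linear : ∀ {n} (a : Fin n → ℕ) → IsLinear (dot a)
dot-linear a = record
  { respects = λ eq → sumℚ-cong (λ j → cong (ℕtoℚ (a j) ℚ.*_) (eq j))
  ; at-zero  = zeros a
  ; additive = additive a }
  where
  zeros : ∀ {n} (a : Fin n → ℕ) → dot a (λ _ → 0ℚ) ≡ 0ℚ
  zeros {zero}  a = refl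
  zeros {suc n} a = cong₂ ℚ._+_ (ℚₚ.*-zeroʳ (ℕtoℚ (a Fin.zero))) (zeros (a ∘ Fin.suc))
  open ℚSolver.+-*-Solver
  additive : ∀ {n} (a : Fin n → ℕ) q y w →
    dot a (λ j → q ℚ.* y j ℚ.+ w j) ≡ q ℚ.* dot a y ℚ.+ dot a w
  additive {zero}  a q y w = sym (trans (ℚₚ.+-identityʳ (q ℚ.* 0ℚ)) (ℚₚ.*-zeroʳ q))
  additive {suc n} a q y w = trans
    (cong (ℕtoℚ (a Fin.zero) ℚ.* (q ℚ.* y Fin.zero ℚ.+ w Fin.zero) ℚ.+_)
      (additive (a ∘ Fin.suc) q (y ∘ Fin.suc) (w ∘ Fin.suc)))
    (solve 6 (λ c q y w s t → c :* (q :* y :+ w) :+ (q :* s :+ t) := q :* (c :* y :+ s) :+ (c :* w :+ t)) refl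
      (ℕtoℚ (a Fin.zero)) q (y Fin.zero) (w Fin.zero)
      (dot (a ∘ Fin.suc) (y ∘ Fin.suc)) (dot (a ∘ Fin.suc) (w ∘ Fin.suc)))

combination-bound : ∀ {n F} → IsLinear {n} F → ∀ d L →
  All (λ p → 0ℚ ℚ.≤ proj₁ p × d ℚ.≤ F (ℤtoℚ ∘ proj₂ p)) L → total L ℚ.* d ℚ.≤ F (combination L)
combination-bound lin d [] [] = ℚₚ.≤-reflexive (trans (ℚₚ.*-zeroˡ d) (sym (IsLinear.at-zero lin)))
combination-bound {F = F} lin d ((q , z) ∷ L) ((q≥0 , le) ∷ all) = begin
  (q ℚ.+ total L) ℚ.* d                         ≡⟨ ℚₚ.*-distribʳ-+ d q (total L) ⟩
  q ℚ.* d ℚ.+ total L ℚ.* d                     ≤⟨ ℚₚ.+-mono-≤ (ℚₚ.*-monoˡ-≤-nonNeg q {{ℚ.nonNegative q≥0}} le)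
                                                     (combination-bound lin d L all) ⟩
  q ℚ.* F (ℤtoℚ ∘ z) ℚ.+ F (combination L)      ≡⟨ IsLinear.additive lin q (ℤtoℚ ∘ z) (combination L) ⟨
  F (combination ((q , z) ∷ L))                 ∎
  where open ℚₚ.≤-Reasoning

InQstar-bound : ∀ {m n F} (A : Fin m → Fin n → ℕ) α x → IsLinear {n} F → ∀ d →
  (∀ z → Feasible A (+ α) z → d ℚ.≤ F (ℤtoℚ ∘ z)) → InQstar A α x → d ℚ.≤ F x
InQstar-bound {F = F} A α x lin d valid c@(L , all , _) = begin
  d                  ≡⟨ ℚₚ.*-identityˡ d ⟨
  1ℚ ℚ.* d           ≡⟨ cong (ℚ._* d) (InQstar-total A α x c) ⟨
  total L ℚ.* d      ≤⟨ combination-bound lin d L (All.map (λ { {_ , z} (q≥0 , z∈Q) → q≥0 , valid z (InQ⇒Feasibleℤ A α z∈Q) }) all) ⟩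
  F (combination L)  ≡⟨ IsLinear.respects lin (InQstar-combination A α x c) ⟨
  F x                ∎
  where open ℚₚ.≤-Reasoning

colsum : ∀ {n} → List (Fin n → ℤ) → Fin n → ℤ
colsum []       j = + 0
colsum (z ∷ zs) j = z j + colsum zs j

colsum-++ : ∀ {n} (zs ws : List (Fin n → ℤ)) j → colsum (zs ++ ws) j ≡ colsum zs j + colsum ws j
colsum-++ []       ws j = sym (+-identityˡ (colsum ws j))
colsum-++ (z ∷ zs) ws j = trans (cong (λ r → z j + r) (colsum-++ zs ws j)) (sym (+-assoc (z j) (colsum zs j) (colsum ws j)))

colsum-applyDownFrom : ∀ {n} (w : ℕ → Fin n → ℤ) k j → colsum (applyDownFrom w k) j ≡ psum (λ u → w u j) k
colsum-applyDownFrom w zero    j = refl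
colsum-applyDownFrom w (suc k) j = trans (cong (λ r → w k j + r) (colsum-applyDownFrom w k j)) (+-comm (w k j) _)

module _ {m n} (A : Fin m → Fin n → ℕ) (α : ℕ) (D' : ℕ) where
  open Scaled D'

  -- All weights are 1/D. Repetitions and the length of the list carry the coefficients, so no
  -- rational weights need to be tracked.
  average∈InQstar : ∀ {x X} → x ≗ X /D → (zs : List (Fin n → ℤ)) → All (Feasible A (+ α)) zs →
    length zs ≡ suc D' → (∀ j → X j ≡ colsum zs j) → InQstar A α x
  average∈InQstar {x} {X} eq zs feasible len X≡ =
      map (c ,_) zs , members zs feasible
    , trans (total-eq A α x (map (c ,_) zs)) (trans (total-map zs) (trans (cong (λ k → c ℚ.* ℤtoℚ (+ k)) len) c*D≡1))
    , λ j → trans (x≡ j) (trans (sym (combination-map zs j)) (sym (combination-eq A α x j (map (c ,_) zs))))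
    where
    open ≡-Reasoning
    instance
      D-pos = ℤtoℚ-positive D'
      D-nonZero = ℚₚ.pos⇒nonZero (ℤtoℚ D)
    c : ℚ
    c = ℚ.1/ (ℤtoℚ D)
    c*D≡1 : c ℚ.* ℤtoℚ D ≡ 1ℚ
    c*D≡1 = ℚₚ.*-inverseˡ (ℤtoℚ D)
    c≥0 : 0ℚ ℚ.≤ c
    c≥0 = ℚₚ.<⇒≤ (ℚₚ.positive⁻¹ c {{ℚₚ.1/pos⇒pos (ℤtoℚ D)}})
    members : ∀ zs → All (Feasible A (+ α)) zs → All _ (map (c ,_) zs)
    members [] [] = []
    members (z ∷ zs) (f ∷ fs) = (c≥0 , Feasible⇒InQ A α f) ∷ members zs fs
    total-map : ∀ (zs : List (Fin n → ℤ)) → total (map (c ,_) zs) ≡ c ℚ.* ℤtoℚ (+ length zs)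
    total-map []       = sym (ℚₚ.*-zeroʳ c)
    total-map (z ∷ zs) = begin
      c ℚ.+ total (map (c ,_) zs)                      ≡⟨ cong₂ ℚ._+_ (sym (ℚₚ.*-identityʳ c)) (total-map zs) ⟩
      c ℚ.* 1ℚ ℚ.+ c ℚ.* ℤtoℚ (+ length zs)            ≡⟨ ℚₚ.*-distribˡ-+ c 1ℚ _ ⟨
      c ℚ.* (1ℚ ℚ.+ ℤtoℚ (+ length zs))                ≡⟨ cong (c ℚ.*_) (ℤtoℚ-+ (+ 1) (+ length zs)) ⟨
      c ℚ.* ℤtoℚ (+ suc (length zs))                   ∎
    combination-map : ∀ zs j → combination (map (c ,_) zs) j ≡ c ℚ.* ℤtoℚ (colsum zs j)
    combination-map []       j = sym (ℚₚ.*-zeroʳ c)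
    combination-map (z ∷ zs) j = begin
      c ℚ.* ℤtoℚ (z j) ℚ.+ combination (map (c ,_) zs) j     ≡⟨ cong (c ℚ.* ℤtoℚ (z j) ℚ.+_) (combination-map zs j) ⟩
      c ℚ.* ℤtoℚ (z j) ℚ.+ c ℚ.* ℤtoℚ (colsum zs j)          ≡⟨ ℚₚ.*-distribˡ-+ c (ℤtoℚ (z j)) _ ⟨
      c ℚ.* (ℤtoℚ (z j) ℚ.+ ℤtoℚ (colsum zs j))              ≡⟨ cong (c ℚ.*_) (ℤtoℚ-+ (z j) (colsum zs j)) ⟨
      c ℚ.* ℤtoℚ (z j + colsum zs j)                         ∎
    x≡ : ∀ j → x j ≡ c ℚ.* ℤtoℚ (colsum zs j)
    x≡ j = begin
      x j                         ≡⟨ ℚₚ.*-identityˡ (x j) ⟨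
      1ℚ ℚ.* x j                  ≡⟨ cong (ℚ._* x j) c*D≡1 ⟨
      c ℚ.* ℤtoℚ D ℚ.* x j        ≡⟨ ℚₚ.*-assoc c (ℤtoℚ D) (x j) ⟩
      c ℚ.* (ℤtoℚ D ℚ.* x j)      ≡⟨ cong (c ℚ.*_) (trans (ℚₚ.*-comm (ℤtoℚ D) (x j)) (trans (eq j) (cong ℤtoℚ (X≡ j)))) ⟩
      c ℚ.* ℤtoℚ (colsum zs j)    ∎

-- Rows of a circular matrix

module Rows {m : ℕ} (n' : ℕ) (A : Fin m → Fin (suc n') → ℕ) (ℓ : Fin m → Fin (suc n')) (k : Fin m → ℕ)
            (circular : IsCircular A ℓ k) where

  open Cyclic n'

  -- A lift of ℓ_i - 1, the tail of the row arc.
  start : Fin m → ℕ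
  start i = toℕ (ℓ i) ℕ.+ n'

  k≤n : ∀ i → k i ℕ.≤ n
  k≤n i = ℕₚ.m≤n⇒m≤1+n (proj₁ (proj₂ (circular i)))

  entry : ∀ i j → + A i j ≡ indicator (ℓ i) (k i) j
  entry i j with ℕₚ._<?_ (offset (ℓ i) j) (k i)
  ... | yes lt = trans (cong +_ (proj₁ (proj₂ (proj₂ (circular i)) j) lt)) (sym (indicator-< (ℓ i) (k i) j lt))
  ... | no nlt = trans (cong +_ (proj₂ (proj₂ (proj₂ (circular i)) j) nlt)) (sym (indicator-≮ (ℓ i) (k i) j nlt))

  row-diff : ∀ R {c} → QuasiPeriodic R c → ∀ i → dotℤ (A i) (diff R) ≡ R (start i ℕ.+ k i) - R (start i)
  row-diff R qp i = trans (sum-cong-≗ (λ j → cong (_* diff R j) (entry i j)))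
    (trans (sum-indicator (ℓ i) (diff R) (k i) (k≤n i)) (psum-diff R qp (toℕ (ℓ i)) (k i)))

  -- The constant `c` cancels in R(s + d) - R(s), which is therefore periodic and depends on the
  -- node of s only.
  increment : ∀ R {c} → QuasiPeriodic R c → ∀ d p q → node p ≡ node q → R (p ℕ.+ d) - R p ≡ R (q ℕ.+ d) - R q
  increment R {c} qp d p q eq = trans (sym (periodic h per p)) (trans (cong (h ∘ toℕ) eq) (periodic h per q))
    where
    h : ℕ → ℤ
    h s = R (s ℕ.+ d) - R s
    cancel : ∀ a b c → (a + c) - (b + c) ≡ a - b
    cancel = solve-∀
    per : ∀ s → h (s ℕ.+ n) ≡ h s
    per s = trans (cong₂ _-_ (trans (cong R (swap-last s n d)) (qp (s ℕ.+ d))) (qp s)) (cancel (R (s ℕ.+ d)) (R s) c)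

  row-diff-at : ∀ R {c} → QuasiPeriodic R c → ∀ i p → node p ≡ node (start i) →
    dotℤ (A i) (diff R) ≡ R (p ℕ.+ k i) - R p
  row-diff-at R qp i p eq = trans (row-diff R qp i) (sym (increment R qp (k i) p (start i) eq))

  row-partial-at : ∀ X i p → node p ≡ node (start i) →
    dotℤ (A i) X ≡ partial X (p ℕ.+ k i) - partial X p
  row-partial-at X i p eq = trans (sum-cong-≗ (λ j → cong (+ A i j *_) (sym (diff-partial X j))))
    (row-diff-at (partial X) (partial-qp X) i p eq)

  -- Multiplying a row by the unit vector `δ j` shows its entry in column j as the increment of a
  -- nondecreasing step function over the lifted row. A longer interval has a larger increment, so
  -- containment is domination.
  nested-rows-equal : NoDominatingRows A → ∀ i l p q → node p ≡ node (start i) → node q ≡ node (start l) →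
    q ℕ.≤ p → p ℕ.+ k i ℕ.≤ q ℕ.+ k l → l ≡ i
  nested-rows-equal nodom i l p q p-i q-l q≤p end≤ with l ≟ i
  ... | yes l≡i = l≡i
  ... | no  l≢i = ⊥-elim (nodom l i l≢i dominates)
    where
    δ≥0 : ∀ j j′ → + 0 ≤ δ j j′
    δ≥0 j j′ with toℕ j ≡ᵇ toℕ j′
    ... | true  = +≤+ z≤n
    ... | false = +≤+ z≤n
    column : ∀ i j → dotℤ (A i) (δ j) ≡ + A i j
    column i j = trans (sum-cong-≗ (λ j′ → *-comm (+ A i j′) (δ j j′))) (sum-δ j (λ j′ → + A i j′))
    rearrange : ∀ a b c d → (b - c) - (a - d) ≡ (b - a) + (d - c)
    rearrange = solve-∀
    dominates : Dominates A l i
    dominates j = drop‿+≤+ (subst₂ _≤_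
      (trans (sym (row-partial-at (δ j) i p p-i)) (column i j))
      (trans (sym (row-partial-at (δ j) l q q-l)) (column l j))
      (≤-from-gap (0≤-+ (gap (monotone-≤ G G-mono end≤)) (gap (monotone-≤ G G-mono q≤p)))
        (rearrange (G (p ℕ.+ k i)) (G (q ℕ.+ k l)) (G q) (G p))))
      where
      G : ℕ → ℤ
      G = partial (δ j)
      G-mono : Monotone G
      G-mono = partial-mono (δ j) (δ≥0 j)

  module _ (α : ℕ) where

    -- The values ⌊(R + u)/M⌋, u < M, replace a potential R with increments divisible by M around the
    -- circle by M integral ones; difference constraints survive rounding.
    rounding : ∀ M' R {β} → QuasiPeriodic R (β * + suc M') → Monotone R →
      (∀ i → R (start i) + + α * + suc M' ≤ R (start i ℕ.+ k i)) →
      Σ (List (Fin n → ℤ)) λ zs → All (Feasible A (+ α)) zs × length zs ≡ suc M' × (∀ j → diff R j ≡ colsum zs j)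
    rounding M' R {β} qp mono rows =
        applyDownFrom w M
      , All.applyDownFrom⁺₂ w M feasible
      , length-applyDownFrom w M
      , λ j → sym (trans (colsum-applyDownFrom w M j) (sum-rounded n' R mono j))
      where
      open Floor M'
      w : ℕ → Fin n → ℤ
      w u = diff (rounded n' R u)
      move : ∀ a s t → t - s - a ≡ t - (s + a)
      move = solve-∀
      feasible : ∀ u → Feasible A (+ α) (w u)
      feasible u =
          (λ i → subst (+ α ≤_) (sym (row-diff (rounded n' R u) (rounded-qp n' R {β} qp u) i))
            (≤-from-gap (gap (rounded-gap n' R {+ α} {start i} {start i ℕ.+ k i} (rows i) u))
              (move (+ α) (rounded n' R u (start i)) (rounded n' R u (start i ℕ.+ k i)))))
        , diff-mono (rounded n' R u) (rounded-mono n' R mono u)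

-- Circuits

module Circuits {m : ℕ} (n' : ℕ) (A : Fin m → Fin (suc n') → ℕ) (ℓ : Fin m → Fin (suc n')) (k : Fin m → ℕ)
                (circular : IsCircular A ℓ k) where

  open Cyclic n'
  open Rows n' A ℓ k circular

  private
    Γs = List (Arc m n)
    NoRev = NoReverseRowArcs ℓ k

  node-row-end : ∀ i → node (toℕ (ℓ i) ℕ.+ (k i ℕ.+ n')) ≡ node (start i ℕ.+ k i)
  node-row-end i = cong node (trans (sym (ℕₚ.+-assoc (toℕ (ℓ i)) (k i) n')) (swap-last (toℕ (ℓ i)) (k i) n'))

  node-short-end : ∀ j → node (suc (toℕ j ℕ.+ n')) ≡ j
  node-short-end j = trans (cong node (sym (ℕₚ.+-suc (toℕ j) n'))) (trans (node-+n (toℕ j)) (node-toℕ j))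

  arcWeight : (Fin n → ℤ) → Arc m n → ℤ
  arcWeight X (rowF i)   = dotℤ (A i) X
  arcWeight X (shortF j) = X j
  arcWeight X (rowR i)   = - dotℤ (A i) X
  arcWeight X (shortR j) = - X j

  weight : (Fin n → ℤ) → Γs → ℤ
  weight X []      = + 0
  weight X (e ∷ Γ) = arcWeight X e + weight X Γ

  module _ (X : Fin n → ℤ) where

    -- The partial sum minus its mean slope S / n, times n to stay integral. It is periodic, hence a
    -- function of the node, and its change along an arc is n times the weight minus S times the
    -- length.
    potential : ℕ → ℤ
    potential s = + n * partial X s - sum X * + s

    potential-node : ∀ s → potential (toℕ (node s)) ≡ potential s
    potential-node = periodic potential (λ s → trans
      (cong₂ (λ a b → + n * a - sum X * b) (partial-qp X s) (pos-+ s n))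
      (cancel (+ n) (partial X s) (sum X) (+ s)))
      where
      cancel : ∀ n g x s → n * (g + x) - x * (s + n) ≡ n * g - x * s
      cancel = solve-∀

    at : Fin n → ℤ
    at v = potential (toℕ v)

    row-drop : ∀ i → + n * dotℤ (A i) X - sum X * + k i ≡
      at (headA ℓ k (rowF i)) - at (tailA ℓ k (rowF i))
    row-drop i = begin
      + n * dotℤ (A i) X - sum X * + k i
        ≡⟨ cong (λ r → + n * r - sum X * + k i) (row-partial-at X i (start i) refl) ⟩
      + n * (partial X (start i ℕ.+ k i) - partial X (start i)) - sum X * + k i
        ≡⟨ split (+ n) (partial X (start i ℕ.+ k i)) (partial X (start i)) (sum X) (+ k i) (+ start i) ⟩
      (+ n * partial X (start i ℕ.+ k i) - sum X * (+ start i + + k i)) - potential (start i)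
        ≡⟨ cong₂ _-_ (trans (cong (λ r → + n * partial X (start i ℕ.+ k i) - sum X * r) (sym (pos-+ (start i) (k i))))
             (trans (sym (potential-node (start i ℕ.+ k i))) (cong at (sym (node-row-end i)))))
             (sym (potential-node (start i))) ⟩
      at (headA ℓ k (rowF i)) - at (tailA ℓ k (rowF i)) ∎
      where
      open ≡-Reasoning
      split : ∀ n a b x k s → n * (a - b) - x * k ≡ (n * a - x * (s + k)) - (n * b - x * s)
      split = solve-∀

    short-drop : ∀ j → + n * X j - sum X * + 1 ≡ at j - at (tailA ℓ k (shortF j))
    short-drop j = begin
      + n * X j - sum X * + 1
        ≡⟨ split (+ n) (partial X s) (X j) (sum X) (+ s) ⟩
      (+ n * (partial X s + X j) - sum X * (+ 1 + + s)) - potential s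
        ≡⟨ cong (λ v → (+ n * (partial X s + X v) - sum X * (+ 1 + + s)) - potential s) (sym (node-short-end j)) ⟩
      potential (suc s) - potential s
        ≡⟨ cong₂ _-_ (trans (sym (potential-node (suc s))) (cong at (node-short-end j))) (sym (potential-node s)) ⟩
      at j - at (tailA ℓ k (shortF j)) ∎
      where
      open ≡-Reasoning
      s : ℕ
      s = toℕ j ℕ.+ n'
      split : ∀ n g y x s → n * y - x * + 1 ≡ (n * (g + y) - x * (+ 1 + s)) - (n * g - x * s)
      split = solve-∀

    reverse-drop : ∀ c w l a b → c * w - sum X * l ≡ a - b → c * - w - sum X * - l ≡ b - a
    reverse-drop c w l a b eq = trans (neg-lhs c w (sum X) l) (trans (cong -_ eq) (neg-rhs a b))
      where
      neg-lhs : ∀ c w x l → c * - w - x * - l ≡ - (c * w - x * l)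
      neg-lhs = solve-∀
      neg-rhs : ∀ a b → - (a - b) ≡ b - a
      neg-rhs = solve-∀

    arc-drop : ∀ e → + n * arcWeight X e - sum X * lengthA ℓ k e ≡ at (headA ℓ k e) - at (tailA ℓ k e)
    arc-drop (rowF i)   = row-drop i
    arc-drop (shortF j) = short-drop j
    arc-drop (rowR i)   = reverse-drop (+ n) (dotℤ (A i) X) (+ k i) (at (headA ℓ k (rowF i))) (at (tailA ℓ k (rowF i))) (row-drop i)
    arc-drop (shortR j) = reverse-drop (+ n) (X j) (+ 1) (at j) (at (tailA ℓ k (shortF j))) (short-drop j)

    walk-drop : ∀ {u v} Γ → Walk ℓ k u Γ v → + n * weight X Γ - sum X * totalLength ℓ k Γ ≡ at v - at u
    walk-drop {u} [] refl = trans (zeros (+ n) (sum X)) (sym (+-inverseʳ (at u)))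
      where
      zeros : ∀ n x → n * + 0 - x * + 0 ≡ + 0
      zeros = solve-∀
    walk-drop {u} {v} (e ∷ Γ) (refl , walk) = begin
      + n * (arcWeight X e + weight X Γ) - sum X * (lengthA ℓ k e + totalLength ℓ k Γ)
        ≡⟨ split (+ n) (arcWeight X e) (weight X Γ) (sum X) (lengthA ℓ k e) (totalLength ℓ k Γ) ⟩
      (+ n * arcWeight X e - sum X * lengthA ℓ k e) + (+ n * weight X Γ - sum X * totalLength ℓ k Γ)
        ≡⟨ cong₂ _+_ (arc-drop e) (walk-drop Γ walk) ⟩
      (at (headA ℓ k e) - at (tailA ℓ k e)) + (at v - at (headA ℓ k e))
        ≡⟨ telescope (at (headA ℓ k e)) (at (tailA ℓ k e)) (at v) ⟩
      at v - at (tailA ℓ k e) ∎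
      where
      open ≡-Reasoning
      split : ∀ n a b x l t → n * (a + b) - x * (l + t) ≡ (n * a - x * l) + (n * b - x * t)
      split = solve-∀
      telescope : ∀ h t v → (h - t) + (v - h) ≡ v - t
      telescope = solve-∀

    closed-weight : ∀ {u} Γ → Walk ℓ k u Γ u → + n * weight X Γ ≡ sum X * totalLength ℓ k Γ
    closed-weight {u} Γ walk = i-j≡0⇒i≡j (+ n * weight X Γ) _ (trans (walk-drop Γ walk) (+-inverseʳ (at u)))

    -- A closed walk has no net change of `potential`, so n times its weight equals S times its
    -- length p n: every column is covered p times net.
    winding-weight : ∀ {u} Γ p → Walk ℓ k u Γ u → WindingNumber ℓ k Γ p → weight X Γ ≡ p * sum X
    winding-weight Γ p walk winding = *-cancelˡ-≡ (+ n) _ _ (trans (closed-weight Γ walk)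
      (trans (cong (sum X *_) (sym winding)) (swap (sum X) p (+ n))))
      where
      swap : ∀ x p n → x * (p * n) ≡ n * (p * x)
      swap = solve-∀

  -- The net number of arcs jumping over one fixed column serves as witness: it is the weight of a
  -- vector of sum 1.
  winding-number : ∀ {u} Γ → Walk ℓ k u Γ u → ∃[ p ] WindingNumber ℓ k Γ p
  winding-number Γ walk = weight (δ Fin.zero) Γ , (begin
    weight (δ Fin.zero) Γ * + n                             ≡⟨ *-comm (weight (δ Fin.zero) Γ) (+ n) ⟩
    + n * weight (δ Fin.zero) Γ                             ≡⟨ closed-weight (δ Fin.zero) Γ walk ⟩
    sum (δ {n} Fin.zero) * totalLength ℓ k Γ                ≡⟨ cong (_* totalLength ℓ k Γ) sum-δ-1 ⟩
    + 1 * totalLength ℓ k Γ                                 ≡⟨ *-identityˡ (totalLength ℓ k Γ) ⟩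
    totalLength ℓ k Γ                                       ∎)
    where
    open ≡-Reasoning
    sum-δ-1 : sum (δ {n} Fin.zero) ≡ + 1
    sum-δ-1 = trans (sum-cong-≗ (λ j → sym (*-identityʳ (δ {n} Fin.zero j)))) (sum-δ {n} Fin.zero (λ _ → + 1))

  shortRWeight : (Fin n → ℤ) → Γs → ℤ
  shortRWeight X []             = + 0
  shortRWeight X (shortR j ∷ Γ) = X j + shortRWeight X Γ
  shortRWeight X (_ ∷ Γ)        = shortRWeight X Γ

  shortRWeight≥0 : ∀ {X} → (∀ j → + 0 ≤ X j) → ∀ Γ → + 0 ≤ shortRWeight X Γ
  shortRWeight≥0 X≥0 []             = ≤-refl
  shortRWeight≥0 X≥0 (rowF i ∷ Γ)   = shortRWeight≥0 X≥0 Γ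
  shortRWeight≥0 X≥0 (shortF j ∷ Γ) = shortRWeight≥0 X≥0 Γ
  shortRWeight≥0 X≥0 (rowR i ∷ Γ)   = shortRWeight≥0 X≥0 Γ
  shortRWeight≥0 X≥0 (shortR j ∷ Γ) = 0≤-+ (X≥0 j) (shortRWeight≥0 X≥0 Γ)

  dotℤ-+ : ∀ {n} (a b : Fin n → ℕ) X → dotℤ (λ j → a j ℕ.+ b j) X ≡ dotℤ a X + dotℤ b X
  dotℤ-+ a b X = trans
    (sum-cong-≗ (λ j → trans (cong (_* X j) (pos-+ (a j) (b j))) (*-distribʳ-+ (X j) (+ a j) (+ b j))))
    (∑-distrib-+ (λ j → + a j * X j) (λ j → + b j * X j))

  -- Without reverse row arcs only the reverse short arcs contribute to p⁻, each of them one unit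
  -- vector.
  pMinus-weight : ∀ X Γ → NoRev Γ → dotℤ (pMinus ℓ k Γ) X ≡ shortRWeight X Γ
  pMinus-weight X []             _        = sum-zero _ (λ j → *-zeroˡ (X j))
  pMinus-weight X (rowF i ∷ Γ)   (_ ∷ nr) = pMinus-weight X Γ nr
  pMinus-weight X (shortF j ∷ Γ) (_ ∷ nr) = pMinus-weight X Γ nr
  pMinus-weight X (rowR i ∷ Γ)   (h ∷ _)  = ⊥-elim (h tt)
  pMinus-weight X (shortR v ∷ Γ) (_ ∷ nr) = begin
    dotℤ (λ j → (if toℕ v ≡ᵇ toℕ j then 1 else 0) ℕ.+ pMinus ℓ k Γ j) X
      ≡⟨ dotℤ-+ (λ j → if toℕ v ≡ᵇ toℕ j then 1 else 0) (pMinus ℓ k Γ) X ⟩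
    dotℤ (λ j → if toℕ v ≡ᵇ toℕ j then 1 else 0) X + dotℤ (pMinus ℓ k Γ) X
      ≡⟨ cong₂ _+_ (trans (sum-cong-≗ (λ j → cong (_* X j) (if-pos (toℕ v ≡ᵇ toℕ j)))) (sum-δ v X))
           (pMinus-weight X Γ nr) ⟩
    X v + shortRWeight X Γ ∎
    where
    open ≡-Reasoning
    if-pos : ∀ b → + (if b then 1 else 0) ≡ (if b then + 1 else + 0)
    if-pos true  = refl
    if-pos false = refl

  revRowSum-0 : ∀ α Γ → NoRev Γ → revRowSum ℓ k α Γ ≡ 0
  revRowSum-0 α []             _        = refl
  revRowSum-0 α (rowF i ∷ Γ)   (_ ∷ nr) = revRowSum-0 α Γ nr
  revRowSum-0 α (shortF j ∷ Γ) (_ ∷ nr) = revRowSum-0 α Γ nr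
  revRowSum-0 α (rowR i ∷ Γ)   (h ∷ _)  = ⊥-elim (h tt)
  revRowSum-0 α (shortR v ∷ Γ) (_ ∷ nr) = revRowSum-0 α Γ nr

  module _ {α : ℕ} {D : ℤ} {X : Fin n → ℤ} (feasible : Feasible A (+ α * D) X) where

    -- Arc by arc: a forward row arc weighs at least α D, a forward short arc at least 0, and the
    -- negative weight of a reverse short arc is refunded by `shortRWeight`.
    cover : ∀ Γ → NoRev Γ → tVal ℓ k α Γ * D ≤ weight X Γ + shortRWeight X Γ
    cover []             _        = ≤-reflexive (*-zeroˡ D)
    cover (rowF i ∷ Γ)   (_ ∷ nr) = ≤-from-gap (0≤-+ (gap (proj₁ feasible i)) (gap (cover Γ nr)))
        (split (dotℤ (A i) X) (weight X Γ) (shortRWeight X Γ) (+ α) (tVal ℓ k α Γ) D)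
      where
      split : ∀ r w s a t d → r + w + s - (a + t) * d ≡ (r - a * d) + (w + s - t * d)
      split = solve-∀
    cover (shortF j ∷ Γ) (_ ∷ nr) = ≤-from-gap (0≤-+ (proj₂ feasible j) (gap (cover Γ nr)))
        (split (X j) (weight X Γ) (shortRWeight X Γ) (tVal ℓ k α Γ * D))
      where
      split : ∀ x w s t → x + w + s - t ≡ x + (w + s - t)
      split = solve-∀
    cover (rowR i ∷ Γ)   (h ∷ _)  = ⊥-elim (h tt)
    cover (shortR j ∷ Γ) (_ ∷ nr) = ≤-from-gap (gap (cover Γ nr))
        (split (X j) (weight X Γ) (shortRWeight X Γ) (tVal ℓ k α Γ * D))
      where
      split : ∀ x w s t → - x + w + (x + s) - t ≡ w + s - t
      split = solve-∀

    closed-cover : ∀ {u} Γ p → Walk ℓ k u Γ u → NoRev Γ → WindingNumber ℓ k Γ p →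
      tVal ℓ k α Γ * D ≤ p * sum X + shortRWeight X Γ
    closed-cover Γ p walk nr winding = subst (λ w → tVal ℓ k α Γ * D ≤ w + shortRWeight X Γ)
      (winding-weight X Γ p walk winding) (cover Γ nr)

  Γ-row-weight : ∀ X Γ r → NoRev Γ → dotℤ (λ j → pMinus ℓ k Γ j ℕ.+ r) X ≡ shortRWeight X Γ + + r * sum X
  Γ-row-weight X Γ r nr = trans (dotℤ-+ (pMinus ℓ k Γ) (λ _ → r) X)
    (cong₂ _+_ (pMinus-weight X Γ nr) (sym (*-distribˡ-sum (+ r) X)))

-- Longest walks

module LongestWalks {m n : ℕ} (ℓ : Fin m → Fin n) (k : Fin m → ℕ) (g : Arc m n → ℤ) where

  private
    Γs = List (Arc m n)
    NoRev = NoReverseRowArcs ℓ k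
    tl = tailA ℓ k
    hd = headA ℓ k

  gain : Γs → ℤ
  gain []      = + 0
  gain (e ∷ Γ) = g e + gain Γ

  gain-++ : ∀ Γ Δ → gain (Γ ++ Δ) ≡ gain Γ + gain Δ
  gain-++ []      Δ = sym (+-identityˡ (gain Δ))
  gain-++ (e ∷ Γ) Δ = trans (cong (λ r → g e + r) (gain-++ Γ Δ)) (sym (+-assoc (g e) (gain Γ) (gain Δ)))

  walk-++ : ∀ {u v w} Γ {Δ} → Walk ℓ k u Γ v → Walk ℓ k v Δ w → Walk ℓ k u (Γ ++ Δ) w
  walk-++ []      refl       walk′ = walk′
  walk-++ (e ∷ Γ) (eq , walk) walk′ = eq , walk-++ Γ walk walk′

  walk-split : ∀ {u v} Γ {e Δ} → Walk ℓ k u (Γ ++ e ∷ Δ) v → Walk ℓ k u Γ (tl e) × Walk ℓ k (tl e) (e ∷ Δ) v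
  walk-split []      (eq , walk) = sym eq , refl , walk
  walk-split (_ ∷ Γ) (eq , walk) = (eq , proj₁ (walk-split Γ walk)) , proj₂ (walk-split Γ walk)

  DistinctTails : Γs → Set
  DistinctTails = AllPairs (λ e e′ → tl e ≢ tl e′)

  distinct-++ : ∀ Γ {Δ} → DistinctTails (Γ ++ Δ) → DistinctTails Γ × DistinctTails Δ
  distinct-++ []      d       = [] , d
  distinct-++ (e ∷ Γ) (a ∷ d) = All.++⁻ˡ Γ a ∷ proj₁ (distinct-++ Γ d) , proj₂ (distinct-++ Γ d)

  lookup-injective : ∀ {Γ} → DistinctTails Γ → ∀ i j → tl (lookup Γ i) ≡ tl (lookup Γ j) → i ≡ j
  lookup-injective (a ∷ d) Fin.zero    Fin.zero    eq = refl
  lookup-injective (a ∷ d) Fin.zero    (Fin.suc j) eq = ⊥-elim (All.lookup a (∈-lookup j) eq)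
  lookup-injective (a ∷ d) (Fin.suc i) Fin.zero    eq = ⊥-elim (All.lookup a (∈-lookup i) (sym eq))
  lookup-injective (a ∷ d) (Fin.suc i) (Fin.suc j) eq = cong Fin.suc (lookup-injective d i j eq)

  distinct-length : ∀ {Γ} → DistinctTails Γ → length Γ ℕ.≤ n
  distinct-length d = injective⇒≤ (λ {i} {j} → lookup-injective d i j)

  FirstAt : Fin n → Γs → Set
  FirstAt v Γ = Σ Γs λ Γ₁ → Σ (Arc m n) λ e → Σ Γs λ Γ₂ →
    Γ ≡ Γ₁ ++ e ∷ Γ₂ × tl e ≡ v × All (λ e′ → v ≢ tl e′) Γ₁

  first-at : ∀ v Γ → All (λ e → v ≢ tl e) Γ ⊎ FirstAt v Γ
  first-at v []      = inj₁ []
  first-at v (e ∷ Γ) with v ≟ tl e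
  ... | yes v≡e = inj₂ ([] , e , Γ , refl , sym v≡e , [])
  ... | no  v≢e with first-at v Γ
  ...   | inj₁ all = inj₁ (v≢e ∷ all)
  ...   | inj₂ (Γ₁ , e′ , Γ₂ , eq , e′≡v , all) = inj₂ (e ∷ Γ₁ , e′ , Γ₂ , cong (e ∷_) eq , e′≡v , v≢e ∷ all)

  module _ (circuit-gain : ∀ Γ → IsCircuit ℓ k Γ → NoRev Γ → gain Γ ≤ + 0) where

    Improvement : Fin n → Γs → Fin n → Set
    Improvement u Γ v = Σ Γs λ Δ → Walk ℓ k u Δ v × NoRev Δ × DistinctTails Δ × gain Γ ≤ gain Δ

    -- The rest of the walk is made loop-free first. If the tail of the new arc recurs there, the
    -- part up to the recurrence is a circuit, and dropping it cannot decrease the gain.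
    erase-loops : ∀ {u v} Γ → Walk ℓ k u Γ v → NoRev Γ → Improvement u Γ v
    erase-loops []      walk nr = [] , walk , [] , [] , ≤-refl
    erase-loops {u} {v} (e ∷ Γ) (refl , walk) (e-nr ∷ nr) with erase-loops Γ walk nr
    ... | Δ , walkΔ , nrΔ , distinct , better with first-at (tl e) Δ
    ...   | inj₁ fresh = e ∷ Δ , (refl , walkΔ) , e-nr ∷ nrΔ , fresh ∷ distinct , +-monoʳ-≤ (g e) better
    ...   | inj₂ (Δ₁ , e′ , Δ₂ , refl , e′≡e , fresh) =
      e′ ∷ Δ₂ , subst (λ w → Walk ℓ k w (e′ ∷ Δ₂) v) e′≡e (proj₂ (walk-split Δ₁ walkΔ))
      , All.++⁻ʳ Δ₁ nrΔ , proj₂ (distinct-++ Δ₁ distinct)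
      , ≤-from-gap (0≤-+ (gap better) (gap (circuit-gain (e ∷ Δ₁) circuit (e-nr ∷ All.++⁻ˡ Δ₁ nrΔ))))
          (trans (rearrange (g e) (gain Γ) (gain Δ₁) (gain (e′ ∷ Δ₂)))
            (cong (λ r → (r - gain Γ) + (+ 0 - (g e + gain Δ₁))) (sym (gain-++ Δ₁ (e′ ∷ Δ₂)))))
      where
      circuit : IsCircuit ℓ k (e ∷ Δ₁)
      circuit = (refl , subst (Walk ℓ k (hd e) Δ₁) e′≡e (proj₁ (walk-split Δ₁ walkΔ)))
        , AllPairs.map⁺ {xs = e ∷ Δ₁} (fresh ∷ proj₁ (distinct-++ Δ₁ distinct))
      rearrange : ∀ a b c d → d - (a + b) ≡ ((c + d) - b) + (+ 0 - (a + c))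
      rearrange = solve-∀

    arcs : Γs
    arcs = map rowF (allFin m) ++ map shortF (allFin n) ++ map shortR (allFin n)

    arcs-NoRev : NoRev arcs
    arcs-NoRev = All.++⁺ (All.map⁺ (All.universal (λ _ ()) (allFin m)))
      (All.++⁺ (All.map⁺ (All.universal (λ _ ()) (allFin n))) (All.map⁺ (All.universal (λ _ ()) (allFin n))))

    ∈-arcs : ∀ e → ¬ IsRevRow ℓ k e → e ∈ arcs
    ∈-arcs (rowF i)   _ = ∈-++⁺ˡ (∈-map⁺ rowF (∈-allFin i))
    ∈-arcs (shortF j) _ = ∈-++⁺ʳ (map rowF (allFin m)) (∈-++⁺ˡ (∈-map⁺ shortF (∈-allFin j)))
    ∈-arcs (rowR i)   h = ⊥-elim (h tt)
    ∈-arcs (shortR j) _ = ∈-++⁺ʳ (map rowF (allFin m)) (∈-++⁺ʳ (map shortF (allFin n)) (∈-map⁺ shortR (∈-allFin j)))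

    -- One relaxation round of the Bellman-Ford method at the node `v`, keeping the old value as a
    -- candidate.
    best : (Fin n → ℤ) → Fin n → Γs → ℤ
    best f v []       = f v
    best f v (e ∷ es) with hd e ≟ v
    ... | yes _ = (f (tl e) + g e) ⊔ best f v es
    ... | no  _ = best f v es

    best-≥ : ∀ f v es → f v ≤ best f v es
    best-≥ f v []       = ≤-refl
    best-≥ f v (e ∷ es) with hd e ≟ v
    ... | yes _ = ≤-trans (best-≥ f v es) (i≤j⊔i (f (tl e) + g e) (best f v es))
    ... | no  _ = best-≥ f v es

    best-arc : ∀ f {e} es → e ∈ es → f (tl e) + g e ≤ best f (hd e) es
    best-arc f {e} (e′ ∷ es) (here refl) with hd e ≟ hd e
    ... | yes _ = i≤i⊔j (f (tl e) + g e) (best f (hd e) es)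
    ... | no  h = ⊥-elim (h refl)
    best-arc f {e} (e′ ∷ es) (there e∈es) with hd e′ ≟ hd e
    ... | yes _ = ≤-trans (best-arc f es e∈es) (i≤j⊔i (f (tl e′) + g e′) (best f (hd e) es))
    ... | no  _ = best-arc f es e∈es

    best-elim : ∀ (P : Fin n → ℤ → Set) f v es → NoRev es → P v (f v) →
      (∀ e → ¬ IsRevRow ℓ k e → P (hd e) (f (tl e) + g e)) → P v (best f v es)
    best-elim P f v []       _          base step = base
    best-elim P f v (e ∷ es) (e-nr ∷ nr) base step with hd e ≟ v
    ... | no  _    = best-elim P f v es nr base step
    ... | yes refl with ⊔-sel (f (tl e) + g e) (best f v es)
    ...   | inj₁ eq = subst (P v) (sym eq) (step e e-nr)
    ...   | inj₂ eq = subst (P v) (sym eq) (best-elim P f v es nr base step)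

    module _ (f : Fin n → ℤ) where

      iterate : ℕ → Fin n → ℤ
      iterate zero    v = f v
      iterate (suc t) v = best (iterate t) v arcs

      iterate-≤ : ∀ t c v → iterate t v ≤ iterate (t ℕ.+ c) v
      iterate-≤ t zero    v = ≤-reflexive (cong (λ r → iterate r v) (sym (ℕₚ.+-identityʳ t)))
      iterate-≤ t (suc c) v = subst (λ r → iterate t v ≤ iterate r v) (sym (ℕₚ.+-suc t c))
        (≤-trans (iterate-≤ t c v) (best-≥ (iterate (t ℕ.+ c)) v arcs))

      Attained : Fin n → ℤ → Set
      Attained v a = Σ (Fin n) λ u → Σ Γs λ Γ → Walk ℓ k u Γ v × NoRev Γ × a ≡ f u + gain Γ

      attained : ∀ t v → Attained v (iterate t v)
      attained zero    v = v , [] , refl , [] , sym (+-identityʳ (f v))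
      attained (suc t) v = best-elim Attained (iterate t) v arcs arcs-NoRev (attained t v) extend
        where
        move : ∀ a b c → a + b + c ≡ a + (b + (c + + 0))
        move = solve-∀
        extend : ∀ e → ¬ IsRevRow ℓ k e → Attained (hd e) (iterate t (tl e) + g e)
        extend e e-nr with attained t (tl e)
        ... | u , Γ , walk , nr , eq = u , Γ ++ e ∷ [] , walk-++ Γ walk (refl , refl) , All.++⁺ nr (e-nr ∷ [])
          , trans (cong (_+ g e) eq) (trans (move (f u) (gain Γ) (g e)) (cong (λ r → f u + r) (sym (gain-++ Γ (e ∷ [])))))

      walk-bound : ∀ t c {u v} Γ → Walk ℓ k u Γ v → NoRev Γ → length Γ ℕ.≤ c →
        iterate t u + gain Γ ≤ iterate (t ℕ.+ c) v
      walk-bound t c {u} [] refl _ _ = subst (_≤ iterate (t ℕ.+ c) u) (sym (+-identityʳ (iterate t u))) (iterate-≤ t c u)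
      walk-bound t (suc c) {u} {v} (e ∷ Γ) (refl , walk) (e-nr ∷ nr) (s≤s len) = begin
        iterate t u + (g e + gain Γ)         ≡⟨ +-assoc (iterate t u) (g e) (gain Γ) ⟨
        iterate t u + g e + gain Γ           ≤⟨ +-monoˡ-≤ (gain Γ) (best-arc (iterate t) arcs (∈-arcs e e-nr)) ⟩
        iterate (suc t) (hd e) + gain Γ      ≤⟨ walk-bound (suc t) c Γ walk nr len ⟩
        iterate (suc t ℕ.+ c) v              ≡⟨ cong (λ r → iterate r v) (ℕₚ.+-suc t c) ⟨
        iterate (t ℕ.+ suc c) v              ∎
        where open ≤-Reasoning

      -- `n` rounds are enough, since a walk with distinct tails has at most `n` arcs.
      longest : Fin n → ℤ
      longest = iterate n

      longest-≥ : ∀ v → f v ≤ longest v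
      longest-≥ v = iterate-≤ 0 n v

      -- The left side is attained by some walk extended by `e`; its loop-free replacement has at
      -- most `n` arcs and so was already taken into account.
      longest-closed : ∀ e → ¬ IsRevRow ℓ k e → longest (tl e) + g e ≤ longest (hd e)
      longest-closed e e-nr with attained n (tl e)
      ... | u , Γ , walk , nr , eq with erase-loops (Γ ++ e ∷ []) (walk-++ Γ walk (refl , refl)) (All.++⁺ nr (e-nr ∷ []))
      ...   | Δ , walkΔ , nrΔ , distinct , better = begin
        longest (tl e) + g e             ≡⟨ cong (_+ g e) eq ⟩
        f u + gain Γ + g e               ≡⟨ move (f u) (gain Γ) (g e) ⟩
        f u + (gain Γ + (g e + + 0))     ≡⟨ cong (λ r → f u + r) (gain-++ Γ (e ∷ [])) ⟨
        f u + gain (Γ ++ e ∷ [])         ≤⟨ +-monoʳ-≤ (f u) better ⟩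
        f u + gain Δ                     ≤⟨ walk-bound 0 n Δ walkΔ nrΔ (distinct-length distinct) ⟩
        longest (hd e)                   ∎
        where
        open ≤-Reasoning
        move : ∀ a b c → a + b + c ≡ a + (b + (c + + 0))
        move = solve-∀

      -- Induction along the rounds. The extra premise `a ≤ longest (tl e)`, from the monotonicity
      -- of the rounds, allows `P` to compare an intermediate value with the final potential.
      longest-elim : ∀ (P : Fin n → ℤ → Set) → (∀ v → P v (f v)) →
        (∀ e → ¬ IsRevRow ℓ k e → ∀ a → a ≤ longest (tl e) → P (tl e) a → P (hd e) (a + g e)) →
        ∀ v → P v (longest v)
      longest-elim P base step = go n 0 (ℕₚ.+-identityʳ n)
        where
        go : ∀ t d → t ℕ.+ d ≡ n → ∀ v → P v (iterate t v)
        go zero    d eq v = base v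
        go (suc t) d eq v = best-elim P (iterate t) v arcs arcs-NoRev (go t (suc d) eq′ v)
            (λ e e-nr → step e e-nr (iterate t (tl e))
              (subst (λ r → iterate t (tl e) ≤ iterate r (tl e)) eq′ (iterate-≤ t (suc d) (tl e)))
              (go t (suc d) eq′ (tl e)))
          where
          eq′ : t ℕ.+ suc d ≡ n
          eq′ = trans (ℕₚ.+-suc t d) eq

-- Validity of the Γ-inequalities

-- For σ ≤ β the covering inequality gives the bound with slack (p - r)(β - σ); for σ ≥ β + 1 the
-- term r σ alone reaches r (β + 1).
Γ-inequality-integral : ∀ {t p β r σ P} → + 0 ≤ P → + 0 ≤ r → + 0 ≤ p - r → t ≡ β * p + r →
  t ≤ p * σ + P → r * (β + + 1) ≤ P + r * σ
Γ-inequality-integral {t} {p} {β} {r} {σ} {P} P≥0 r≥0 p≥r refl cover with ≤-or-> σ β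
... | inj₁ σ≤β = ≤-from-gap (0≤-+ (gap cover) (0≤-* p≥r (gap σ≤β))) (lem p β r σ P)
  where
  lem : ∀ p β r σ P → P + r * σ - r * (β + + 1) ≡ (p * σ + P - (β * p + r)) + (p - r) * (β - σ)
  lem = solve-∀
... | inj₂ β<σ = ≤-from-gap (0≤-+ P≥0 (0≤-* r≥0 (gap-< β<σ))) (lem β r σ P)
  where
  lem : ∀ β r σ P → P + r * σ - r * (β + + 1) ≡ P + r * (σ - β - + 1)
  lem = solve-∀

module Validity {m : ℕ} (n' : ℕ) (A : Fin m → Fin (suc n') → ℕ) (ℓ : Fin m → Fin (suc n')) (k : Fin m → ℕ)
                (circular : IsCircular A ℓ k) (α : ℕ) where

  open Cyclic n'
  open Rows n' A ℓ k circular
  open Circuits n' A ℓ k circular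

  circuit-closed : ∀ Γ → IsCircuit ℓ k Γ → ∃[ u ] Walk ℓ k u Γ u
  circuit-closed (e ∷ Γ) (walk , _) = tailA ℓ k e , walk

  Γ-valid : ∀ Γ p → IsCircuit ℓ k Γ → NoReverseRowArcs ℓ k Γ → WindingNumber ℓ k Γ (+ p) →
    ∀ β r → tVal ℓ k α Γ ≡ β * + p + + r → r ℕ.< p → ∀ z → Feasible A (+ α) z →
    ℤtoℚ (+ r * (β + + 1) + + revRowSum ℓ k α Γ) ℚ.≤ dot (λ j → pMinus ℓ k Γ j ℕ.+ r) (ℤtoℚ ∘ z)
  Γ-valid Γ p circuit nr winding β r t≡ r<p z feasible with circuit-closed Γ circuit
  ... | u , walk = unclear-≤ rhs (dot-scaled (λ j → pMinus ℓ k Γ j ℕ.+ r) {ℤtoℚ ∘ z} {z} (≗/1 A α z))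
    (subst₂ _≤_
      (sym (trans (*-identityʳ rhs) (trans (cong (λ s → + r * (β + + 1) + + s) (revRowSum-0 α Γ nr)) (+-identityʳ _))))
      (sym (Γ-row-weight z Γ r nr))
      (Γ-inequality-integral {tVal ℓ k α Γ} {+ p} {β} {+ r} {sum z}
        (shortRWeight≥0 (proj₂ feasible) Γ) (+≤+ z≤n) (gap (+≤+ (ℕₚ.<⇒≤ r<p))) t≡
        (subst (_≤ + p * sum z + shortRWeight z Γ) (*-identityʳ (tVal ℓ k α Γ))
          (closed-cover {α} {+ 1} {z} (subst (λ b → Feasible A b z) (sym (*-identityʳ (+ α))) feasible)
            Γ (+ p) walk nr winding))))
    where
    open Scaled 0
    rhs : ℤ
    rhs = + r * (β + + 1) + + revRowSum ℓ k α Γ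

  InQstar⇒InSystem : ∀ x → InQstar A α x → InSystem ℓ k A α x
  InQstar⇒InSystem x c =
      ( (λ i → InQstar-bound A α x (dot-linear (A i)) (ℕtoℚ α) (λ z f → proj₁ (Feasible⇒InQ A α f) i) c)
      , (λ j → InQstar-bound A α x (eval-linear j) 0ℚ (λ z f → proj₂ (Feasible⇒InQ A α f) j) c) )
    , λ Γ p circuit nr winding _ _ β r t≡ r<p →
        InQstar-bound A α x (dot-linear (λ j → pMinus ℓ k Γ j ℕ.+ r))
          (ℤtoℚ (+ r * (β + + 1) + + revRowSum ℓ k α Γ))
          (Γ-valid Γ p circuit nr winding β r t≡ r<p) c

-- Sufficiency of the Γ-inequalities

-- Only the residues 0 < t - β p < p need more than the covering inequality.
circuit-bound : ∀ {U T D S β t p P} → D ≡ U + T → S ≡ T + β * D → + 0 ≤ U → + 0 ≤ T → + 0 ≤ P →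
  t * D ≤ p * S + P →
  (∀ r → t ≡ β * p + + r → + 0 < + r → + r < p → + r * (β + + 1) * D ≤ P + + r * S) →
  U * (t - β * p) ≤ P
circuit-bound {U} {T} {_} {_} {β} {t} {p} {P} refl refl U≥0 T≥0 P≥0 cover Γ-ineq with ≤-or-> (t - β * p) (+ 0)
... | inj₁ ρ≤0 = ≤-from-gap (0≤-+ P≥0 (0≤-* U≥0 (gap ρ≤0))) (lem P U (t - β * p))
  where
  lem : ∀ P U ρ → P - U * ρ ≡ P + U * (+ 0 - ρ)
  lem = solve-∀
... | inj₂ 0<ρ with ≤-or-> p (t - β * p)
-- With ρ = t - β p one has t D - p S = U ρ + T (ρ - p), so covering suffices. Circuits with p ≤ 0
-- and ρ > 0 also end up here.
...   | inj₁ p≤ρ = ≤-from-gap (0≤-+ (gap cover) (0≤-* T≥0 (gap p≤ρ))) (lem U T β t p P)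
  where
  lem : ∀ U T β t p P → P - U * (t - β * p) ≡
    (p * (T + β * (U + T)) + P - t * (U + T)) + T * (t - β * p - p)
  lem = solve-∀
-- Only now does β, the integer part of 1·x, coincide with ⌊t/p⌋, with remainder ρ. The Γ-inequality
-- becomes the claim because (β + 1) D - S = U.
...   | inj₂ ρ<p = ≤-from-gap
    (gap (Γ-ineq ∣ t - β * p ∣ (trans (restore t (β * p)) (cong (λ r → β * p + r) (sym ρ≡)))
      (subst (+ 0 <_) (sym ρ≡) 0<ρ) (subst (_< p) (sym ρ≡) ρ<p)))
    (trans (lem U T β (t - β * p) P)
      (cong (λ r → P + r * (T + β * (U + T)) - r * (β + + 1) * (U + T)) (sym ρ≡)))
  where
  ρ≡ : + ∣ t - β * p ∣ ≡ t - β * p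
  ρ≡ = 0≤i⇒+∣i∣≡i (<⇒≤ 0<ρ)
  restore : ∀ t b → t ≡ b + (t - b)
  restore = solve-∀
  lem : ∀ U T β ρ P → P - U * ρ ≡ P + ρ * (T + β * (U + T)) - ρ * (β + + 1) * (U + T)
  lem = solve-∀

indivisible : ∀ {t β p r} → t ≡ β * + p + + r → + 0 < + r → + r < + p → ¬ (+ p ∣ℤ t)
indivisible {t} {β} {p} {suc r} refl _ (+<+ r<p) p∣t = >⇒∤ r<p (∣⇒∣ᵤ (∣m+n∣m⇒∣n {+ p} {β * + p} {+ suc r} (∣ᵤ⇒∣ p∣t) (∣n⇒∣m*n β ∣-refl)))
indivisible {r = zero} _ (+<+ ()) _ _

module CircuitBound {m : ℕ} (n' : ℕ) (A : Fin m → Fin (suc n') → ℕ) (ℓ : Fin m → Fin (suc n')) (k : Fin m → ℕ)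
                    (circular : IsCircular A ℓ k) (α : ℕ) where

  open Cyclic n'
  open Rows n' A ℓ k circular
  open Circuits n' A ℓ k circular
  open Validity n' A ℓ k circular α using (circuit-closed)

  module _ (D' : ℕ) where
    open Scaled D'

    system-bound : ∀ {x X U T β} → x ≗ X /D → InSystem ℓ k A α x →
      D ≡ U + T → sum X ≡ T + β * D → + 0 ≤ U → + 0 ≤ T →
      ∀ Γ p → IsCircuit ℓ k Γ → NoReverseRowArcs ℓ k Γ → WindingNumber ℓ k Γ p →
      U * (tVal ℓ k α Γ - β * p) ≤ shortRWeight X Γ
    system-bound {x} {X} {U} {T} {β} eq (x∈Q , ineqs) D≡ S≡ U≥0 T≥0 Γ p circuit nr winding =
      circuit-bound {U} {T} {D} {sum X} {β} {tVal ℓ k α Γ} {p} {shortRWeight X Γ} D≡ S≡ U≥0 T≥0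
        (shortRWeight≥0 (proj₂ feasible) Γ)
        (closed-cover feasible Γ p (proj₂ (circuit-closed Γ circuit)) nr winding)
        (Γ-ineq p winding)
      where
      feasible : Feasible A (+ α * D) X
      feasible = InQ⇒Feasible A α D' eq x∈Q
      Γ-ineq : ∀ p → WindingNumber ℓ k Γ p → ∀ r → tVal ℓ k α Γ ≡ β * p + + r → + 0 < + r → + r < p →
        + r * (β + + 1) * D ≤ shortRWeight X Γ + + r * sum X
      Γ-ineq (+ p) winding r t≡ 0<r r<p@(+<+ r<p′) = subst₂ _≤_
        (cong (_* D) (trans (cong (λ s → + r * (β + + 1) + + s) (revRowSum-0 α Γ nr)) (+-identityʳ (+ r * (β + + 1)))))
        (Γ-row-weight X Γ r nr)
        (clear-≤ (+ r * (β + + 1) + + revRowSum ℓ k α Γ) (dot-scaled (λ j → pMinus ℓ k Γ j ℕ.+ r) {x} {X} eq)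
          -- The remainder satisfies 0 < r < p, which yields both p ≥ 2 and the indivisibility of t.
          (ineqs Γ p circuit nr winding (ℕₚ.≤-trans (s≤s (drop‿+<+ 0<r)) r<p′)
            (indivisible {tVal ℓ k α Γ} {β} t≡ 0<r r<p) β r t≡ r<p′))

-- A potential Π on the line with Π(s + n) = Π(s) + K U β, K = n S, whose differences are K times the
-- part of x lying in the slice of sum β; the complementary differences of K G - Π, where G is the
-- partial sum of X, give the slice of sum β + 1.  Π is the longest-walk closure, over the forward
-- row and short arcs, of the potential U β n G of the proportional splitting of X.
module Potential {m : ℕ} (n' : ℕ) (A : Fin m → Fin (suc n') → ℕ) (ℓ : Fin m → Fin (suc n')) (k : Fin m → ℕ)
                 (circular : IsCircular A ℓ k) (α : ℕ) where

  open Cyclic n'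
  open Rows n' A ℓ k circular
  open Circuits n' A ℓ k circular

  module _ (X : Fin n → ℤ) (U T D β : ℤ) where

    private
      NoRev = NoReverseRowArcs ℓ k
      N = + n
      S = sum X
      G = partial X

    -- The factor S clears the denominator of the proportional share U β / S, the factor n that of
    -- the mean slope U β / n.
    K : ℤ
    K = N * S

    -- K U β / n, the mean increase of Π per position. Removing it turns the lifted potential into a
    -- function of the node.
    slope : ℤ
    slope = S * U * β

    -- Each gain is the right-hand side of a constraint on Π minus `slope` times the length of the
    -- arc: rows of the lower part are at least K U α, and its coordinates lie between 0 and K X j.
    arcGain : Arc m n → ℤ
    arcGain (rowF i)   = K * U * + α - slope * + k i
    arcGain (shortF j) = - slope
    arcGain (rowR i)   = + 0
    arcGain (shortR j) = slope - K * X j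

    open LongestWalks ℓ k arcGain

    gain-formula : ∀ Γ → NoRev Γ →
      gain Γ ≡ K * U * tVal ℓ k α Γ - K * shortRWeight X Γ - slope * totalLength ℓ k Γ
    gain-formula []             _        = lem K U slope
      where
      lem : ∀ K U s → + 0 ≡ K * U * + 0 - K * + 0 - s * + 0
      lem = solve-∀
    gain-formula (rowF i ∷ Γ)   (_ ∷ nr) = trans (cong (λ r → arcGain (rowF i) + r) (gain-formula Γ nr))
        (lem K U slope (+ α) (+ k i) (tVal ℓ k α Γ) (shortRWeight X Γ) (totalLength ℓ k Γ))
      where
      lem : ∀ K U s a k t P L → K * U * a - s * k + (K * U * t - K * P - s * L) ≡
        K * U * (a + t) - K * P - s * (k + L)
      lem = solve-∀
    gain-formula (shortF j ∷ Γ) (_ ∷ nr) = trans (cong (λ r → - slope + r) (gain-formula Γ nr))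
        (lem K U slope (tVal ℓ k α Γ) (shortRWeight X Γ) (totalLength ℓ k Γ))
      where
      lem : ∀ K U s t P L → - s + (K * U * t - K * P - s * L) ≡ K * U * t - K * P - s * (+ 1 + L)
      lem = solve-∀
    gain-formula (rowR i ∷ Γ)   (h ∷ _)  = ⊥-elim (h tt)
    gain-formula (shortR j ∷ Γ) (_ ∷ nr) = trans (cong (λ r → arcGain (shortR j) + r) (gain-formula Γ nr))
        (lem K U slope (X j) (tVal ℓ k α Γ) (shortRWeight X Γ) (totalLength ℓ k Γ))
      where
      lem : ∀ K U s x t P L → s - K * x + (K * U * t - K * P - s * L) ≡
        K * U * t - K * (x + P) - s * (- + 1 + L)
      lem = solve-∀

    module _ (D≡ : D ≡ U + T) (S≡ : S ≡ T + β * D) (U>0 : + 0 < U) (T>0 : + 0 < T) (β≥0 : + 0 ≤ β)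
             (feasible : Feasible A (+ α * D) X)
             (circuits : ∀ Γ p → IsCircuit ℓ k Γ → NoRev Γ → WindingNumber ℓ k Γ p →
               U * (tVal ℓ k α Γ - β * p) ≤ shortRWeight X Γ) where

      private
        U≥0 = <⇒≤ U>0
        T≥0 = <⇒≤ T>0
        X≥0 = proj₂ feasible
        N≥0 : + 0 ≤ N
        N≥0 = +≤+ z≤n

      S≥0 : + 0 ≤ S
      S≥0 = sum-≥0 X X≥0

      K≥0 : + 0 ≤ K
      K≥0 = 0≤-* N≥0 S≥0

      -- The total length is p n and n times `slope` is K U β, so the gain equals K (U (t - β p) -
      -- P), where P is the weight of the reverse short arcs.
      circuit-gain : ∀ Γ → IsCircuit ℓ k Γ → NoRev Γ → gain Γ ≤ + 0
      circuit-gain Γ@(_ ∷ _) circuit@(walk , _) nr with winding-number Γ walk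
      ... | p , winding = ≤-from-gap (0≤-* K≥0 (gap (circuits Γ p circuit nr winding)))
          (trans (cong (λ r → + 0 - r) (trans (gain-formula Γ nr)
              (cong (λ L → K * U * tVal ℓ k α Γ - K * shortRWeight X Γ - slope * L) (sym winding))))
            (lem N S U β (tVal ℓ k α Γ) p (shortRWeight X Γ)))
        where
        lem : ∀ N S U β t p P → + 0 - (N * S * U * t - N * S * P - S * U * β * (p * N)) ≡
          N * S * (P - U * (t - β * p))
        lem = solve-∀

      initial : Fin n → ℤ
      initial v = U * β * potential X (toℕ v)

      initial-lift : ∀ s → initial (node s) + slope * + s ≡ U * β * (N * G s)
      initial-lift s = trans (cong (λ r → U * β * r + slope * + s) (potential-node X s)) (lem N S U β (G s) (+ s))
        where
        lem : ∀ N S U β g s → U * β * (N * g - S * s) + S * U * β * s ≡ U * β * (N * g)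
        lem = solve-∀

      ϖ : Fin n → ℤ
      ϖ = longest circuit-gain initial

      ϖ-closed : ∀ e → ¬ IsRevRow ℓ k e → ϖ (tailA ℓ k e) + arcGain e ≤ ϖ (headA ℓ k e)
      ϖ-closed = longest-closed circuit-gain initial

      Π : ℕ → ℤ
      Π s = ϖ (node s) + slope * + s

      Π-qp : QuasiPeriodic Π (β * (K * U))
      Π-qp s = trans (cong (λ v → ϖ v + slope * + (s ℕ.+ n)) (node-+n s)) (lem N S U β (ϖ (node s)) (+ s))
        where
        lem : ∀ N S U β w s → w + S * U * β * (s + N) ≡ w + S * U * β * s + β * (N * S * U)
        lem = solve-∀

      node-pred : ∀ s → node (toℕ (node (suc s)) ℕ.+ n') ≡ node s
      node-pred s = trans (node-+ (suc s) n') (trans (cong node (sym (ℕₚ.+-suc s n'))) (node-+n s))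

      Π-mono : Monotone Π
      Π-mono s = ≤-from-gap (gap (subst (λ v → ϖ v + - slope ≤ ϖ (node (suc s))) (node-pred s)
          (ϖ-closed (shortF (node (suc s))) (λ ()))))
          (lem slope (ϖ (node s)) (ϖ (node (suc s))) (+ s))
        where
        lem : ∀ c a b s → b + c * (+ 1 + s) - (a + c * s) ≡ b - (a + - c)
        lem = solve-∀

      complement : ℕ → ℤ
      complement s = K * G s - Π s

      complement-mono : Monotone complement
      complement-mono s = ≤-from-gap (gap (subst (λ v → ϖ (node (suc s)) + (slope - K * X (node (suc s))) ≤ ϖ v) (node-pred s)
          (ϖ-closed (shortR (node (suc s))) (λ ()))))
          (lem slope K (G s) (X (node (suc s))) (ϖ (node s)) (ϖ (node (suc s))) (+ s))
        where
        lem : ∀ c K g x a b s → K * (g + x) - (b + c * (+ 1 + s)) - (K * g - (a + c * s)) ≡ a - (b + (c - K * x))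
        lem = solve-∀

      -- What remains of K S after removing K U β is K T (β + 1), since S = U β + T (β + 1).
      complement-qp : QuasiPeriodic complement ((β + + 1) * (K * T))
      complement-qp s = trans (cong₂ (λ a b → K * a - b) (partial-qp X s) (Π-qp s))
          (lem N S U T D β (G s) (Π s) D≡ S≡)
        where
        solved : ∀ N U T β g w →
          N * (T + β * (U + T)) * (g + (T + β * (U + T))) - (w + β * (N * (T + β * (U + T)) * U)) ≡
          N * (T + β * (U + T)) * g - w + (β + + 1) * (N * (T + β * (U + T)) * T)
        solved = solve-∀
        lem : ∀ N S U T D β g w → D ≡ U + T → S ≡ T + β * D →
          N * S * (g + S) - (w + β * (N * S * U)) ≡ N * S * g - w + (β + + 1) * (N * S * T)
        lem N _ U T _ β g w refl refl = solved N U T β g w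

      Π-row : ∀ i → Π (start i) + K * U * + α ≤ Π (start i ℕ.+ k i)
      Π-row i = ≤-from-gap (gap (subst (λ v → ϖ (node (start i)) + arcGain (rowF i) ≤ ϖ v) (node-row-end i)
          (ϖ-closed (rowF i) (λ ()))))
          (lem slope (K * U * + α) (ϖ (node (start i))) (ϖ (node (start i ℕ.+ k i))) (+ start i) (+ k i))
        where
        lem : ∀ c r a b s k → b + c * (s + k) - (a + c * s + r) ≡ b - (a + (r - c * k))
        lem = solve-∀

      -- Bound on the value a of a walk ending at v whose last row arc is row i, read at the lifted
      -- positions p (tail of the row arc) and s (end of the walk).
      record ViaRow (v : Fin n) (a : ℤ) : Set where
        constructor via
        field
          row      : Fin m
          p s      : ℕ
          s-node   : node s ≡ v
          p-node   : node p ≡ node (start row)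
          forward  : a + slope * + s ≤ Π p + K * U * + α
          backward : a + slope * + s ≤ Π p + K * U * + α + K * (G s - G (p ℕ.+ k row))

      -- The invariant of the closure. The left case absorbs walks without row arcs, as the
      -- proportional potential already satisfies the short arc constraints. In the right case,
      -- after the last row arc a forward short arc gains nothing on the line and a reverse one
      -- costs K X j, so both bounds of `ViaRow` persist whichever way the walk turns.
      Reach : Fin n → ℤ → Set
      Reach v a = a ≤ initial v ⊎ ViaRow v a

      node-suc : ∀ s j → node s ≡ node (toℕ j ℕ.+ n') → node (suc s) ≡ j
      node-suc s j eq = begin
        node (suc s)                                    ≡⟨ cong node (ℕₚ.+-comm 1 s) ⟩
        node (s ℕ.+ 1)                                  ≡⟨ node-+ s 1 ⟨
        node (toℕ (node s) ℕ.+ 1)                       ≡⟨ cong (λ v → node (toℕ v ℕ.+ 1)) eq ⟩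
        node (toℕ (node (toℕ j ℕ.+ n')) ℕ.+ 1)          ≡⟨ node-+ (toℕ j ℕ.+ n') 1 ⟩
        node (toℕ j ℕ.+ n' ℕ.+ 1)                       ≡⟨ cong node (ℕₚ.+-comm (toℕ j ℕ.+ n') 1) ⟩
        node (suc (toℕ j ℕ.+ n'))                       ≡⟨ node-short-end j ⟩
        j                                               ∎
        where open ≡-Reasoning

      initial-shortF : ∀ j → initial (tailA ℓ k (shortF j)) + - slope ≤ initial j
      initial-shortF j = subst (λ v → initial (node s) + - slope ≤ initial v) (node-short-end j)
          (≤-from-gap (0≤-* (0≤-* U≥0 β≥0) (0≤-* N≥0 (X≥0 (node (suc s)))))
            (trans (lem slope (initial (node s)) (initial (node (suc s))) (+ s))
              (trans (cong₂ _-_ (initial-lift (suc s)) (initial-lift s)) (lem₂ (U * β) N (G s) (X (node (suc s)))))))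
        where
        s : ℕ
        s = toℕ j ℕ.+ n'
        lem : ∀ c a b s → b - (a + - c) ≡ (b + c * (+ 1 + s)) - (a + c * s)
        lem = solve-∀
        lem₂ : ∀ c N g x → c * (N * (g + x)) - c * (N * g) ≡ c * (N * x)
        lem₂ = solve-∀

      -- The proportional share does not exceed X, because S - U β = T (β + 1) is nonnegative.
      initial-shortR : ∀ j → initial j + (slope - K * X j) ≤ initial (headA ℓ k (shortR j))
      initial-shortR j = subst (λ v → initial v + (slope - K * X v) ≤ initial (node s)) (node-short-end j)
          (≤-from-gap (0≤-* (0≤-* N≥0 (X≥0 (node (suc s)))) (0≤-* T≥0 (0≤-+ β≥0 (+≤+ z≤n))))
            (trans (lem slope (K * X (node (suc s))) (initial (node s)) (initial (node (suc s))) (+ s))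
              (trans (cong₂ (λ a b → a - (b - K * X (node (suc s)))) (initial-lift s) (initial-lift (suc s)))
                (lem₂ N S U T D β (G s) (X (node (suc s))) D≡ S≡))))
        where
        s : ℕ
        s = toℕ j ℕ.+ n'
        lem : ∀ c y a b s → a - (b + (c - y)) ≡ (a + c * s) - ((b + c * (+ 1 + s)) - y)
        lem = solve-∀
        solved : ∀ N U T β g x →
          U * β * (N * g) - (U * β * (N * (g + x)) - N * (T + β * (U + T)) * x) ≡ N * x * (T * (β + + 1))
        solved = solve-∀
        lem₂ : ∀ N S U T D β g x → D ≡ U + T → S ≡ T + β * D →
          U * β * (N * g) - (U * β * (N * (g + x)) - N * S * x) ≡ N * x * (T * (β + + 1))
        lem₂ N _ U T _ β g x refl refl = solved N U T β g x

      Reach-step : ∀ e → ¬ IsRevRow ℓ k e → ∀ a → a ≤ ϖ (tailA ℓ k e) →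
        Reach (tailA ℓ k e) a → Reach (headA ℓ k e) (a + arcGain e)
      -- A new row arc discards the history: the bound of `a` by the final potential at the tail is
      -- all that is kept.
      Reach-step (rowF i) _ a a≤ϖ _ = inj₂ (via i (start i) (start i ℕ.+ k i) (sym (node-row-end i)) refl
          (≤-from-gap (gap a≤ϖ) (lem a (ϖ (node (start i))) slope (+ start i) (+ k i) (K * U * + α)))
          (≤-from-gap (gap a≤ϖ) (lem₂ a (ϖ (node (start i))) slope (+ start i) (+ k i) (K * U * + α) K (G (start i ℕ.+ k i)))))
        where
        lem : ∀ a w c s k r → w + c * s + r - (a + (r - c * k) + c * (s + k)) ≡ w - a
        lem = solve-∀
        lem₂ : ∀ a w c s k r K g → w + c * s + r + K * (g - g) - (a + (r - c * k) + c * (s + k)) ≡ w - a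
        lem₂ = solve-∀
      Reach-step (rowR i) h a _ _ = ⊥-elim (h tt)
      Reach-step (shortF j) _ a _ (inj₁ a≤) = inj₁ (≤-trans (+-monoˡ-≤ (- slope) a≤) (initial-shortF j))
      Reach-step (shortF j) _ a _ (inj₂ (via i p s s-node p-node fwd bwd)) =
          inj₂ (via i p (suc s) (node-suc s j s-node) p-node
            (≤-from-gap (gap fwd) (lem a slope (+ s) (Π p + K * U * + α)))
            (≤-from-gap (0≤-+ (gap bwd) (0≤-* K≥0 (X≥0 (node (suc s)))))
              (lem₂ a slope (+ s) (Π p + K * U * + α) K (G s) (X (node (suc s))) (G (p ℕ.+ k i)))))
        where
        lem : ∀ a c s b → b - (a + - c + c * (+ 1 + s)) ≡ b - (a + c * s)
        lem = solve-∀
        lem₂ : ∀ a c s b K g x h → b + K * (g + x - h) - (a + - c + c * (+ 1 + s)) ≡ (b + K * (g - h) - (a + c * s)) + K * x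
        lem₂ = solve-∀
      Reach-step (shortR j) _ a _ (inj₁ a≤) = inj₁ (≤-trans (+-monoˡ-≤ (slope - K * X j) a≤) (initial-shortR j))
      Reach-step (shortR j) _ a _ (inj₂ (via i p s s-node p-node fwd bwd)) =
          -- A step back from s to s - 1 is taken one turn further on, where s - 1 becomes s + n'
          -- and p becomes p + n.
          inj₂ (via i (p ℕ.+ n) (s ℕ.+ n')
            (trans (sym (node-+ s n')) (cong (λ v → node (toℕ v ℕ.+ n')) s-node))
            (trans (node-+n p) p-node)
            (≤-from-gap (0≤-+ (gap fwd) (0≤-* K≥0 (X≥0 j)))
              (trans (cong (λ w → w + K * U * + α - value) (Π-qp p))
                (lem a (+ n') S U β (+ s) (Π p) (+ α) (X j))))
            (≤-from-gap (gap bwd)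
              (trans (cong₂ (λ w d → w + K * U * + α + K * d - value) (Π-qp p) G-diff)
                (lem₂ a (+ n') S U β (+ s) (Π p) (+ α) (X j) (G s) (G (p ℕ.+ k i))))))
        where
        value : ℤ
        value = a + (slope - K * X j) + slope * + (s ℕ.+ n')
        G-s : G (s ℕ.+ n') ≡ G s + S - X j
        G-s = trans (lem (G (s ℕ.+ n')) (X (node (suc (s ℕ.+ n')))))
            (cong₂ _-_ (trans (cong G (sym (ℕₚ.+-suc s n'))) (partial-qp X s))
              (cong X (trans (cong node (sym (ℕₚ.+-suc s n'))) (trans (node-+n s) s-node))))
          where
          lem : ∀ g x → g ≡ g + x - x
          lem = solve-∀
        G-diff : G (s ℕ.+ n') - G (p ℕ.+ n ℕ.+ k i) ≡ (G s + S - X j) - (G (p ℕ.+ k i) + S)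
        G-diff = cong₂ _-_ G-s (trans (cong G (swap-last p n (k i))) (partial-qp X (p ℕ.+ k i)))
        lem : ∀ a n' S U β s w al x → w + β * ((+ 1 + n') * S * U) + (+ 1 + n') * S * U * al -
            (a + (S * U * β - (+ 1 + n') * S * x) + S * U * β * (s + n')) ≡
          (w + (+ 1 + n') * S * U * al - (a + S * U * β * s)) + (+ 1 + n') * S * x
        lem = solve-∀
        lem₂ : ∀ a n' S U β s w al x g h →
          w + β * ((+ 1 + n') * S * U) + (+ 1 + n') * S * U * al + (+ 1 + n') * S * ((g + S - x) - (h + S)) -
            (a + (S * U * β - (+ 1 + n') * S * x) + S * U * β * (s + n')) ≡
          w + (+ 1 + n') * S * U * al + (+ 1 + n') * S * (g - h) - (a + S * U * β * s)
        lem₂ = solve-∀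

      -- Both bounds are invariant under a common shift of p and s by whole turns. This aligns s
      -- with the end of the row under test, which is known only modulo `n`.
      ViaRow-turns : ∀ {v a} c (w : ViaRow v a) → ∃[ w′ ] ViaRow.s {v} {a} w′ ≡ ViaRow.s w ℕ.+ c ℕ.* n
      ViaRow-turns zero w = w , sym (ℕₚ.+-identityʳ (ViaRow.s w))
      ViaRow-turns {v} {a} (suc c) (via i p s s-node p-node fwd bwd) with ViaRow-turns {v} {a} c
          (via i (p ℕ.+ n) (s ℕ.+ n) (trans (node-+n s) s-node) (trans (node-+n p) p-node)
            (≤-from-gap (gap fwd)
              (trans (cong (λ w → w + K * U * + α - value) (Π-qp p)) (lem a N S U β (+ s) (Π p) (+ α))))
            (≤-from-gap (gap bwd)
              (trans (cong₂ (λ w d → w + K * U * + α + K * d - value) (Π-qp p)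
                  (cong₂ _-_ (partial-qp X s) (trans (cong G (swap-last p n (k i))) (partial-qp X (p ℕ.+ k i)))))
                (lem₂ a N S U β (+ s) (Π p) (+ α) (G s) (G (p ℕ.+ k i))))))
        where
        value : ℤ
        value = a + slope * + (s ℕ.+ n)
        lem : ∀ a N S U β s w al → w + β * (N * S * U) + N * S * U * al - (a + S * U * β * (s + N)) ≡
          w + N * S * U * al - (a + S * U * β * s)
        lem = solve-∀
        lem₂ : ∀ a N S U β s w al g h →
          w + β * (N * S * U) + N * S * U * al + N * S * ((g + S) - (h + S)) - (a + S * U * β * (s + N)) ≡
          w + N * S * U * al + N * S * (g - h) - (a + S * U * β * s)
        lem₂ = solve-∀
      ... | w′ , eq = w′ , trans eq (ℕₚ.+-assoc s n (c ℕ.* n))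

      module _ (nodom : NoDominatingRows A) where

        -- If row l ends last, Π at its end is at most Π(p) + K U α ≤ Π(q) + K U α, and the
        -- inequality of row l leaves K T α for the complement. If row i ends last, the backward
        -- bound moves the comparison to the end of row i; the inequality of row i and the
        -- monotonicity of `complement` from q to p finish.
        last-row-bound : ∀ l i q p → node q ≡ node (start l) → node p ≡ node (start i) →
          Π (q ℕ.+ k l) ≤ Π p + K * U * + α →
          Π (q ℕ.+ k l) ≤ Π p + K * U * + α + K * (G (q ℕ.+ k l) - G (p ℕ.+ k i)) →
          complement q + K * T * + α ≤ complement (q ℕ.+ k l)
        last-row-bound l i q p q-l p-i fwd bwd with ℕₚ.≤-total (p ℕ.+ k i) (q ℕ.+ k l)
        ... | inj₁ ends = ≤-from-gap
            (0≤-+ (0≤-+ (gap fwd) (gap (monotone-≤ Π Π-mono p≤q))) (0≤-* K≥0 (gap row-l)))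
            (lem K U T D (+ α) (Π q) (Π p) (Π (q ℕ.+ k l)) (G q) (G (q ℕ.+ k l)) D≡)
          where
          row-l : + α * D ≤ G (q ℕ.+ k l) - G q
          row-l = subst (+ α * D ≤_) (row-partial-at X l q q-l) (proj₁ feasible l)
          -- Were row l to start first as well, it would contain row i; then the rows coincide, and
          -- equal lengths order the starts as the ends.
          p≤q : p ℕ.≤ q
          p≤q with ℕₚ.≤-total p q
          ... | inj₁ p≤q = p≤q
          ... | inj₂ q≤p with nested-rows-equal nodom i l p q p-i q-l q≤p ends
          ...   | refl = ℕₚ.+-cancelʳ-≤ (k l) p q ends
          lem : ∀ K U T D a πq πp πe gq ge → D ≡ U + T →
            K * ge - πe - (K * gq - πq + K * T * a) ≡
            (πp + K * U * a - πe) + (πq - πp) + K * (ge - gq - a * D)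
          lem K U T _ a πq πp πe gq ge refl = solved K U T a πq πp πe gq ge
            where
            solved : ∀ K U T a πq πp πe gq ge →
              K * ge - πe - (K * gq - πq + K * T * a) ≡
              (πp + K * U * a - πe) + (πq - πp) + K * (ge - gq - a * (U + T))
            solved = solve-∀
        ... | inj₂ ends = ≤-from-gap
            (0≤-+ (0≤-+ (gap bwd) (gap (monotone-≤ complement complement-mono q≤p))) (0≤-* K≥0 (gap row-i)))
            (lem K U T D (+ α) (Π q) (Π p) (Π (q ℕ.+ k l)) (G q) (G (q ℕ.+ k l)) (G p) (G (p ℕ.+ k i)) D≡)
          where
          row-i : + α * D ≤ G (p ℕ.+ k i) - G p
          row-i = subst (+ α * D ≤_) (row-partial-at X i p p-i) (proj₁ feasible i)
          q≤p : q ℕ.≤ p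
          q≤p with ℕₚ.≤-total q p
          ... | inj₁ q≤p = q≤p
          ... | inj₂ p≤q with nested-rows-equal nodom l i q p q-l p-i p≤q ends
          ...   | refl = ℕₚ.+-cancelʳ-≤ (k i) q p ends
          lem : ∀ K U T D a πq πp πe gq ge gp gi → D ≡ U + T →
            K * ge - πe - (K * gq - πq + K * T * a) ≡
            (πp + K * U * a + K * (ge - gi) - πe) + (K * gp - πp - (K * gq - πq)) + K * (gi - gp - a * D)
          lem K U T _ a πq πp πe gq ge gp gi refl = solved K U T a πq πp πe gq ge gp gi
            where
            solved : ∀ K U T a πq πp πe gq ge gp gi →
              K * ge - πe - (K * gq - πq + K * T * a) ≡
              (πp + K * U * a + K * (ge - gi) - πe) + (K * gp - πp - (K * gq - πq)) + K * (gi - gp - a * (U + T))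
            solved = solve-∀

        complement-row : ∀ l → complement (start l) + K * T * + α ≤ complement (start l ℕ.+ k l)
        complement-row l with longest-elim circuit-gain initial Reach (λ _ → inj₁ ≤-refl) Reach-step (node (start l ℕ.+ k l))
        -- The closure has not risen above the proportional potential at the end of the row and is
        -- not below it at the start. The proportional complement meets the bound with slack N T U
        -- α, because (β + 1) D = S + U.
        ... | inj₁ ϖ≤ = ≤-from-gap
            (0≤-+ (0≤-+ (gap (+-monoˡ-≤ (slope * + e) ϖ≤))
                (gap (+-monoˡ-≤ (slope * + start l) (longest-≥ circuit-gain initial (node (start l))))))
              (0≤-* (0≤-* N≥0 T≥0) (0≤-+ (0≤-* (0≤-+ β≥0 (+≤+ z≤n)) (gap row)) (0≤-* U≥0 (+≤+ z≤n)))))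
            (trans (lem N S U T D β (+ α) (Π (start l)) (Π e) (G (start l)) (G e) D≡ S≡)
              (cong₂ (λ x y → (x - Π e) + (Π (start l) - y) +
                  N * T * ((β + + 1) * (G e - G (start l) - + α * D) + U * + α))
                (sym (initial-lift e)) (sym (initial-lift (start l)))))
          where
          e : ℕ
          e = start l ℕ.+ k l
          row : + α * D ≤ G e - G (start l)
          row = subst (+ α * D ≤_) (row-partial-at X l (start l) refl) (proj₁ feasible l)
          lem : ∀ N S U T D β a πs πe gs ge → D ≡ U + T → S ≡ T + β * D →
            N * S * ge - πe - (N * S * gs - πs + N * S * T * a) ≡
            (U * β * (N * ge) - πe) + (πs - U * β * (N * gs)) +
            N * T * ((β + + 1) * (ge - gs - a * D) + U * a)
          lem N _ U T _ β a πs πe gs ge refl refl = solved N U T β a πs πe gs ge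
            where
            solved : ∀ N U T β a πs πe gs ge →
              N * (T + β * (U + T)) * ge - πe - (N * (T + β * (U + T)) * gs - πs + N * (T + β * (U + T)) * T * a) ≡
              (U * β * (N * ge) - πe) + (πs - U * β * (N * gs)) +
              N * T * ((β + + 1) * (ge - gs - a * (U + T)) + U * a)
            solved = solve-∀
        -- The walk and row l are moved by c and d turns to a common end on the line; the bound is
        -- carried back to `start l` by `increment`.
        ... | inj₂ w with node-≡ (ViaRow.s w) (start l ℕ.+ k l) (ViaRow.s-node w)
        ...   | c , d , s≡ with ViaRow-turns c w
        ...     | via i p s s-node p-node fwd bwd , eq = at-start
          where
          q : ℕ
          q = start l ℕ.+ d ℕ.* n
          q-l : node q ≡ node (start l)
          q-l = shift-turns node node-+n d (start l)
          s≡q+k : s ≡ q ℕ.+ k l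
          s≡q+k = trans eq (trans s≡ (swap-last (start l) (k l) (d ℕ.* n)))
          Π-s : ϖ (node (start l ℕ.+ k l)) + slope * + s ≡ Π (q ℕ.+ k l)
          Π-s = trans (cong (λ v → ϖ v + slope * + s) (sym s-node)) (cong Π s≡q+k)
          shifted : complement q + K * T * + α ≤ complement (q ℕ.+ k l)
          shifted = last-row-bound l i q p q-l p-node
            (subst (_≤ Π p + K * U * + α) Π-s fwd)
            (subst₂ (λ a b → a ≤ Π p + K * U * + α + K * (G b - G (p ℕ.+ k i))) Π-s s≡q+k bwd)
          move : ∀ a b c → b - (a + c) ≡ (b - a) - c
          move = solve-∀
          at-start : complement (start l) + K * T * + α ≤ complement (start l ℕ.+ k l)
          at-start = ≤-from-gap (gap shifted) (trans
            (move (complement (start l)) (complement (start l ℕ.+ k l)) (K * T * + α))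
            (trans (cong (_- K * T * + α) (sym (increment complement complement-qp (k l) q (start l) q-l)))
              (sym (move (complement q) (complement (q ℕ.+ k l)) (K * T * + α)))))

-- Assembling the convex combination from the two slices.

0<-gap : ∀ {a b} → a < b → + 0 < b - a
0<-gap a<b = suc[i]≤j⇒i<j (≤-from-gap (gap-< a<b) refl)

positive-suc : ∀ {a} → + 0 < a → ∃[ b ] a ≡ + suc b
positive-suc {+ suc b} _ = b , refl
positive-suc {+ zero} (+<+ ())

0<-* : ∀ {a b} → + 0 < a → + 0 < b → + 0 < a * b
0<-* {+ suc a} {+ suc b} _ _ = +<+ (s≤s z≤n)
0<-* {+ zero}  (+<+ ()) _
0<-* {+ suc _} {+ zero} _ (+<+ ())

module Decomposition {m : ℕ} (n' : ℕ) (A : Fin m → Fin (suc n') → ℕ) (ℓ : Fin m → Fin (suc n')) (k : Fin m → ℕ)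
                     (circular : IsCircular A ℓ k) (nodom : NoDominatingRows A) (α : ℕ) where

  open Cyclic n'
  open Rows n' A ℓ k circular
  open Circuits n' A ℓ k circular
  open CircuitBound n' A ℓ k circular α

  module _ (D' : ℕ) where
    open Scaled D'

    row-gap : ∀ {X} → Feasible A (+ α * D) X → ∀ i → partial X (start i) + + α * D ≤ partial X (start i ℕ.+ k i)
    row-gap {X} feasible i = ≤-from-gap
        (gap (subst (+ α * D ≤_) (row-partial-at X i (start i) refl) (proj₁ feasible i)))
        (lem (partial X (start i)) (partial X (start i ℕ.+ k i)) (+ α * D))
      where
      lem : ∀ a b c → b - (a + c) ≡ b - a - c
      lem = solve-∀

    integral-sum : ∀ {x X β} → x ≗ X /D → Feasible A (+ α * D) X → sum X ≡ β * D → InQstar A α x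
    integral-sum {x} {X} {β} eq feasible S≡
      with rounding α D' (partial X) {β} (λ s → trans (partial-qp X s) (cong (λ r → partial X s + r) S≡))
             (partial-mono X (proj₂ feasible)) (row-gap feasible)
    ... | zs , all , len , cols = average∈InQstar A α D' eq zs all len (λ j → trans (sym (diff-partial X j)) (cols j))

    -- Rounding Π gives K U integral points and rounding the complement K T of them. Together these
    -- are K D points with sum K X, so their plain average is x and the slices receive the weights U
    -- / D and T / D.
    fractional-sum : ∀ {x X U T β} → x ≗ X /D → InSystem ℓ k A α x →
      D ≡ U + T → sum X ≡ T + β * D → + 0 < U → + 0 < T → + 0 ≤ β → InQstar A α x
    fractional-sum {x} {X} {U} {T} {β} eq system D≡ S≡ U>0 T>0 β≥0 =
      average∈InQstar A α M {x} {λ j → K * X j} scaled (zs₁ ++ zs₂) (All.++⁺ (proj₁ (proj₂ lower)) (proj₁ (proj₂ upper)))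
        len cols
      where
      open ≡-Reasoning
      K : ℤ
      K = + n * sum X
      feasible : Feasible A (+ α * D) X
      feasible = InQ⇒Feasible A α D' eq (proj₁ system)
      K>0 : + 0 < K
      K>0 = 0<-* {+ n} (+<+ (s≤s z≤n)) (subst (+ 0 <_) (sym S≡) (+-mono-<-≤ T>0 (0≤-* β≥0 (+≤+ z≤n))))
      M₁ M₂ M : ℕ
      M₁ = proj₁ (positive-suc (0<-* K>0 U>0))
      M₂ = proj₁ (positive-suc (0<-* K>0 T>0))
      M = M₁ ℕ.+ suc M₂
      KU≡ : K * U ≡ + suc M₁
      KU≡ = proj₂ (positive-suc (0<-* K>0 U>0))
      KT≡ : K * T ≡ + suc M₂
      KT≡ = proj₂ (positive-suc (0<-* K>0 T>0))
      KD≡ : + suc M ≡ K * D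
      KD≡ = begin
        + suc M₁ + + suc M₂    ≡⟨ cong₂ _+_ (sym KU≡) (sym KT≡) ⟩
        K * U + K * T          ≡⟨ *-distribˡ-+ K U T ⟨
        K * (U + T)            ≡⟨ cong (K *_) D≡ ⟨
        K * D                  ∎
      module P = Potential n' A ℓ k circular α
      circuits : ∀ Γ p → IsCircuit ℓ k Γ → NoReverseRowArcs ℓ k Γ → WindingNumber ℓ k Γ p →
        U * (tVal ℓ k α Γ - β * p) ≤ shortRWeight X Γ
      circuits = system-bound D' {x} {X} {U} {T} {β} eq system D≡ S≡ (<⇒≤ U>0) (<⇒≤ T>0)
      Π complement : ℕ → ℤ
      Π = P.Π X U T D β D≡ S≡ U>0 T>0 β≥0 feasible circuits
      complement = P.complement X U T D β D≡ S≡ U>0 T>0 β≥0 feasible circuits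
      Π-qp : QuasiPeriodic Π (β * (K * U))
      Π-qp = P.Π-qp X U T D β D≡ S≡ U>0 T>0 β≥0 feasible circuits
      Rounded : (ℕ → ℤ) → ℕ → Set
      Rounded R N = Σ (List (Fin n → ℤ)) λ zs →
        All (Feasible A (+ α)) zs × length zs ≡ suc N × (∀ j → diff R j ≡ colsum zs j)
      lower : Rounded Π M₁
      lower = rounding α M₁ Π {β} (subst (λ c → QuasiPeriodic Π (β * c)) KU≡ Π-qp)
        (P.Π-mono X U T D β D≡ S≡ U>0 T>0 β≥0 feasible circuits)
        (λ i → subst (λ c → Π (start i) + c ≤ Π (start i ℕ.+ k i)) (trans (cong (_* + α) KU≡) (*-comm (+ suc M₁) (+ α)))
          (P.Π-row X U T D β D≡ S≡ U>0 T>0 β≥0 feasible circuits i))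
      upper : Rounded complement M₂
      upper = rounding α M₂ complement {β + + 1}
        (subst (λ c → QuasiPeriodic complement ((β + + 1) * c)) KT≡
          (P.complement-qp X U T D β D≡ S≡ U>0 T>0 β≥0 feasible circuits))
        (P.complement-mono X U T D β D≡ S≡ U>0 T>0 β≥0 feasible circuits)
        (λ i → subst (λ c → complement (start i) + c ≤ complement (start i ℕ.+ k i))
          (trans (cong (_* + α) KT≡) (*-comm (+ suc M₂) (+ α)))
          (P.complement-row X U T D β D≡ S≡ U>0 T>0 β≥0 feasible circuits nodom i))
      zs₁ zs₂ : List (Fin n → ℤ)
      zs₁ = proj₁ lower
      zs₂ = proj₁ upper
      len : length (zs₁ ++ zs₂) ≡ suc M
      len = trans (length-++ zs₁) (cong₂ ℕ._+_ (proj₁ (proj₂ (proj₂ lower))) (proj₁ (proj₂ (proj₂ upper))))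
      scaled : ∀ j → x j ℚ.* ℤtoℚ (+ suc M) ≡ ℤtoℚ (K * X j)
      scaled j = begin
        x j ℚ.* ℤtoℚ (+ suc M)              ≡⟨ cong (λ c → x j ℚ.* ℤtoℚ c) (trans KD≡ (*-comm K D)) ⟩
        x j ℚ.* ℤtoℚ (D * K)                ≡⟨ cong (x j ℚ.*_) (ℤtoℚ-* D K) ⟩
        x j ℚ.* (ℤtoℚ D ℚ.* ℤtoℚ K)         ≡⟨ ℚₚ.*-assoc (x j) (ℤtoℚ D) (ℤtoℚ K) ⟨
        x j ℚ.* ℤtoℚ D ℚ.* ℤtoℚ K           ≡⟨ cong (ℚ._* ℤtoℚ K) (eq j) ⟩
        ℤtoℚ (X j) ℚ.* ℤtoℚ K               ≡⟨ ℤtoℚ-* (X j) K ⟨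
        ℤtoℚ (X j * K)                      ≡⟨ cong ℤtoℚ (*-comm (X j) K) ⟩
        ℤtoℚ (K * X j)                      ∎
      recombine : ∀ K a b c d → K * (a - b) ≡ (c - d) + ((K * a - c) - (K * b - d))
      recombine = solve-∀
      cols : ∀ j → K * X j ≡ colsum (zs₁ ++ zs₂) j
      cols j = begin
        K * X j                               ≡⟨ cong (K *_) (diff-partial X j) ⟨
        K * diff (partial X) j                ≡⟨ recombine K (partial X (suc (toℕ j ℕ.+ n'))) (partial X (toℕ j ℕ.+ n'))
                                                   (Π (suc (toℕ j ℕ.+ n'))) (Π (toℕ j ℕ.+ n')) ⟩
        diff Π j + diff complement j          ≡⟨ cong₂ _+_ (proj₂ (proj₂ (proj₂ lower)) j) (proj₂ (proj₂ (proj₂ upper)) j) ⟩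
        colsum zs₁ j + colsum zs₂ j           ≡⟨ colsum-++ zs₁ zs₂ j ⟨
        colsum (zs₁ ++ zs₂) j                 ∎

  InSystem⇒InQstar : ∀ x → InSystem ℓ k A α x → InQstar A α x
  InSystem⇒InQstar x system with common-denominator x
  ... | D' , X , eq = split (S %ℕ suc D') refl
    where
    open Scaled D'
    S β : ℤ
    S = sum X
    β = S /ℕ suc D'
    feasible : Feasible A (+ α * D) X
    feasible = InQ⇒Feasible A α D' eq (proj₁ system)
    S≡ : ∀ {T} → S %ℕ suc D' ≡ T → S ≡ + T + β * D
    S≡ {T} eq = trans (a≡a%ℕn+[a/ℕn]*n S (suc D')) (cong (λ t → + t + β * D) eq)
    cancel : ∀ d t → d ≡ (d - t) + t
    cancel = solve-∀
    -- Remainder 0 means that 1·x is integral and one slice suffices; otherwise T and U = D - T are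
    -- both positive.
    split : ∀ T → S %ℕ suc D' ≡ T → InQstar A α x
    split zero    T≡ = integral-sum D' {x} {X} {β} eq feasible (trans (S≡ T≡) (+-identityˡ (β * D)))
    split (suc T) T≡ = fractional-sum D' {x} {X} {D - + suc T} {+ suc T} {β} eq system (cancel D (+ suc T)) (S≡ T≡)
      (0<-gap (+<+ (subst (ℕ._< suc D') T≡ (n%ℕd<d S (suc D'))))) (+<+ (s≤s z≤n))
      (0≤n⇒0≤n/ℕd S (suc D') (sum-≥0 X (proj₂ feasible)))

-- The case of an empty node set.

InQ⇒InQstar-0 : ∀ {m} (A : Fin m → Fin 0 → ℕ) α x → InQ A α x → InQstar A α x
InQ⇒InQstar-0 A α x x∈Q = (1ℚ , λ ()) ∷ [] , (ℚₚ.<⇒≤ (ℚₚ.positive⁻¹ 1ℚ) , proj₁ x∈Q , λ ()) ∷ [] , refl , λ ()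

InQstar⇒InQ-0 : ∀ {m} (A : Fin m → Fin 0 → ℕ) α x → InQstar A α x → InQ A α x
InQstar⇒InQ-0 A α x c = (λ i → InQstar-bound A α x (dot-linear (A i)) (ℕtoℚ α) (λ z f → proj₁ (Feasible⇒InQ A α f) i) c) , λ ()

no-circuit-0 : ∀ {m} (ℓ : Fin m → Fin 0) k Γ → ¬ IsCircuit ℓ k Γ
no-circuit-0 ℓ k (rowF i ∷ _) _ with ℓ i
... | ()
no-circuit-0 ℓ k (rowR i ∷ _) _ with ℓ i
... | ()

theorem5p3 : ∀ {m n : ℕ} (A : Fin m → Fin n → ℕ) (ℓ : Fin m → Fin n) (k : Fin m → ℕ) →
    IsCircular A ℓ k → NoDominatingRows A → (α : ℕ) → (x : Fin n → ℚ) →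
    InQstar A α x ⇔ InSystem ℓ k A α x
theorem5p3 {n = zero}   A ℓ k circular nodom α x = mk⇔
  (λ c → InQstar⇒InQ-0 A α x c , λ Γ p circuit → ⊥-elim (no-circuit-0 ℓ k Γ circuit))
  (λ system → InQ⇒InQstar-0 A α x (proj₁ system))
theorem5p3 {n = suc n'} A ℓ k circular nodom α x = mk⇔
  (Validity.InQstar⇒InSystem n' A ℓ k circular α x)
  (Decomposition.InSystem⇒InQstar n' A ℓ k circular nodom α x)
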